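{- Let $A(t,y,x)=\sum_{n\ge 0}t^n\sum_{\sigma\in\mathcal S_n(123)}y^{\mathrm{des}(\sigma)}x^{321\text{ -mch}(\sigma)}$. Then $$\begin{aligned} A(t,y,x)=1- \frac{1}{2 t y^2 \left(-x^2 t y+x+t\right)^3} \Big(&2 (x-1)^2 t^6 y^3 \left(x^2 y-1\right)^2+t^2 \left(-x^2 (2x+5) y^2+(6 x+2) y-1\right)\\ &+2 t^4 y \left((2-3 x) x^4y^3+\left(3 x^2+2 x-2\right) x^2 y^2-\left(3x^2+x-1\right) y+1\right)\\ &+2 (x-1) t^5 y^2 \left(x^5y^3-3 x^4 y^2+4 x^2 y-x y-1\right)\\ &+2 t^3 y \left(3 x^4y^2-x^3 y-5 x^2 y+x+2\right)+t (4 x y-2)-1\\ &+(t (x y-1)-1)^2\sqrt{4 x^2 t^2 y^2-4 x t y-4 t^2 y+1}\Big). \end{aligned}$$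
   Context: $\mathcal S_n$ is the set of permutations of $\{1,\dots,n\}$ in one-line notation ($\mathcal S_0$ contains only the empty permutation, on which all statistics are $0$). For a word $w$ of distinct integers, $\mathrm{red}(w)$ replaces the $i$-th smallest letter by $i$. $\sigma\in\mathcal S_n$ avoids $\lambda\in\mathcal S_k$ (classical avoidance) if no (not necessarily contiguous) subsequence $\sigma_{i_1}\cdots\sigma_{i_k}$, $i_1<\dots<i_k$, has reduction $\lambda$; $\mathcal S_n(\lambda)$ is the set of such $\sigma$. $\gamma\text{ -mch}(\sigma)$ is the number of $i$ with $\mathrm{red}(\sigma_i\sigma_{i+1}\cdots\sigma_{i+k-1})=\gamma$ for $\gamma\in\mathcal S_k$. $\mathrm{des}(\sigma)=|\{i:\sigma_i>\sigma_{i+1}\}|$. The identity is one of formal power series in $t$ over $\mathbb Q[x,y]$ (quotients taken in the fraction field), and the square root is the power series in $t$ with constant term $1$. -}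

module Defs where

open import Algebra.Bundles using (CommutativeRing; RawRing)
open import Algebra.Definitions using (AlmostLeftCancellative)
open import Algebra.Structures using (IsCommutativeRing)
import Algebra.Consequences.Setoid as Consequences
import Algebra.Morphism.RingMonomorphism as RingMonomorphism
open import Algebra.Morphism.Structures using (IsRingMonomorphism)
import Algebra.Properties.CommutativeMonoid.Sum as Sum
import Algebra.Properties.CommutativeSemigroup as CommutativeSemigroupProperties
import Algebra.Properties.Monoid.Mult as Mult
import Algebra.Properties.Ring as RingProperties
import Algebra.Properties.Semiring.Exp as Exp
open import Data.Fin.Base using (toℕ)
open import Data.List.Base using (List; []; _∷_; length; map; filter; foldr; take; drop; tails; zip; upTo; cartesianProductWith)
import Data.List.Properties as List
open import Data.List.Relation.Binary.Sublist.Propositional using (_⊆_; []; _∷_; _∷ʳ_)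
open import Data.List.Relation.Unary.Unique.DecPropositional using (unique?)
open import Data.Nat.Base as ℕ using (ℕ; zero; suc; _∸_; _≤_; _<_; z≤n; s≤s; s<s; z<s; _⊔_)
import Data.Nat.Properties as ℕ
open import Data.Nat.Induction using (<-rec)
open import Data.Product.Base using (∃; _×_; _,_; proj₁; proj₂)
open import Data.Rational.Base as ℚ using (ℚ; ½)
import Data.Rational.Properties as ℚ
open import Data.Sum.Base using (_⊎_; inj₁; inj₂)
open import Level using (0ℓ) renaming (suc to lsuc; _⊔_ to _⊔ˡ_)
open import Relation.Binary.PropositionalEquality.Core as ≡ using (_≡_)
open import Relation.Nullary using (¬_; Dec; yes; no; Stable; contradiction)
open import Relation.Nullary.Decidable using (¬?; map′; _⊎-dec_; decidable-stable)

-- A permutation of {1,…,n} in one-line notation is a word of length n with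
-- distinct letters from {1,…,n}.

Word : Set
Word = List ℕ

words : ℕ → List ℕ → List Word
words zero    as = [] ∷ []
words (suc k) as = cartesianProductWith _∷_ as (words k as)

𝒮 : ℕ → List Word
𝒮 n = filter (unique? ℕ._≟_) (words n (map suc (upTo n)))

-- The i-th smallest letter of a word of distinct letters is the one with
-- exactly i letters less than or equal to it.

red : Word → Word
red w = map (λ a → length (filter (ℕ._≤? a) w)) w

Contains : Word → Word → Set
Contains λ′ σ = ∃ λ τ → τ ⊆ σ × red τ ≡ λ′

Avoids : Word → Word → Set
Avoids λ′ σ = ¬ Contains λ′ σ

private
  sublist? : {P : Word → Set} → (∀ τ → Dec (P τ)) → ∀ σ → Dec (∃ λ τ → τ ⊆ σ × P τ)
  sublist? P? []      = map′ (λ p → [] , [] , p) (λ { ([] , [] , p) → p }) (P? [])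
  sublist? P? (a ∷ σ) = map′ from to (sublist? P? σ ⊎-dec sublist? (λ τ → P? (a ∷ τ)) σ)
    where
    from : _ ⊎ _ → _
    from (inj₁ (τ , s , p)) = τ , a ∷ʳ s , p
    from (inj₂ (τ , s , p)) = a ∷ τ , ≡.refl ∷ s , p
    to : _ → _ ⊎ _
    to (τ     , _ ∷ʳ s       , p) = inj₁ (τ , s , p)
    to (_ ∷ τ , ≡.refl ∷ s , p) = inj₂ (τ , s , p)

avoids? : ∀ λ′ σ → Dec (Avoids λ′ σ)
avoids? λ′ σ = ¬? (sublist? (λ τ → List.≡-dec ℕ._≟_ (red τ) λ′) σ)

𝒮[_]_ : ℕ → Word → List Word
𝒮[ n ] λ′ = filter (avoids? λ′) (𝒮 n)

des : Word → ℕ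
des σ = length (filter (λ p → proj₂ p ℕ.<? proj₁ p) (zip σ (drop 1 σ)))

-- The tails of σ start at each of its positions; a tail shorter than γ
-- yields too short a window, whose reduction cannot be γ.

_-mch : Word → Word → ℕ
(γ -mch) σ = length (filter (λ w → List.≡-dec ℕ._≟_ (red w) γ) (map (take (length γ)) (tails σ)))

-- Equality of power series over ℚ is not decidable, only stable; stability
-- is what passes from a domain to its power series and gives cancellation.

record IntegralDomain c ℓ : Set (lsuc (c ⊔ˡ ℓ)) where
  field
    commutativeRing   : CommutativeRing c ℓ
  open CommutativeRing commutativeRing public
  field
    1≉0               : 1# ≉ 0#
    *-cancelˡ-nonZero : AlmostLeftCancellative _≈_ 0# _*_
    ≈-stable          : ∀ x y → Stable (x ≈ y)

private
  module NoZeroDivisors {c ℓ} (R : CommutativeRing c ℓ) where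
    open CommutativeRing R
    open RingProperties ring
    open import Relation.Binary.Reasoning.Setoid setoid

    almostCancel : (∀ x y → x ≉ 0# → x * y ≈ 0# → y ≈ 0#) →
                   AlmostLeftCancellative _≈_ 0# _*_
    almostCancel noZD x y z x≉0 xy≈xz = x∙y⁻¹≈ε⇒x≈y y z (noZD x (y - z) x≉0 (begin
      x * (y - z)   ≈⟨ x[y-z]≈xy-xz x y z ⟩
      x * y - x * z ≈⟨ x≈y⇒x∙y⁻¹≈ε xy≈xz ⟩
      0#            ∎))

    noZeroDivisors : AlmostLeftCancellative _≈_ 0# _*_ →
                     ∀ x y → x ≉ 0# → x * y ≈ 0# → y ≈ 0#
    noZeroDivisors cancel x y x≉0 xy≈0 = cancel x y 0# x≉0 (trans xy≈0 (sym (zeroʳ x)))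

module _ {c ℓ} (D : IntegralDomain c ℓ) where
  open IntegralDomain D
  open Exp semiring using (_^_)

  *-nonZero : ∀ {a b} → a ≉ 0# → b ≉ 0# → a * b ≉ 0#
  *-nonZero {a} {b} a≉0 b≉0 ab≈0 =
    b≉0 (NoZeroDivisors.noZeroDivisors commutativeRing *-cancelˡ-nonZero a b a≉0 ab≈0)

  ^-nonZero : ∀ {a} n → a ≉ 0# → a ^ n ≉ 0#
  ^-nonZero zero    a≉0 = 1≉0
  ^-nonZero (suc n) a≉0 = *-nonZero a≉0 (^-nonZero n a≉0)

ℚ-domain : IntegralDomain 0ℓ 0ℓ
ℚ-domain = record
  { commutativeRing   = ℚ.+-*-commutativeRing
  ; 1≉0               = λ ()
  ; *-cancelˡ-nonZero = λ p q r p≢0 → ℚ-cancel p q r {{ℚ.≢-nonZero p≢0}}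
  ; ≈-stable          = λ p q → decidable-stable (p ℚ.≟ q)
  }
  where
  ℚ-cancel : ∀ p q r .{{_ : ℚ.NonZero p}} → p ℚ.* q ≡ p ℚ.* r → q ≡ r
  ℚ-cancel p q r pq≡pr = ≡.trans (≡.sym (strip q)) (≡.trans (≡.cong (ℚ.1/ p ℚ.*_) pq≡pr) (strip r))
    where
    strip : ∀ s → ℚ.1/ p ℚ.* (p ℚ.* s) ≡ s
    strip s = ≡.trans (≡.sym (ℚ.*-assoc (ℚ.1/ p) p s))
             (≡.trans (≡.cong (ℚ._* s) (ℚ.*-inverseˡ p)) (ℚ.*-identityˡ s))

module PowerSeries {c ℓ} (R : CommutativeRing c ℓ) where
  private
    module R = CommutativeRing R
    module +S = CommutativeSemigroupProperties R.+-commutativeSemigroup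
    open Sum R.+-commutativeMonoid using (sum⁺-syntax)
  open import Relation.Binary.Reasoning.Setoid R.setoid

  -- Without eta, conversion checking compares f * g and f′ * g′ by their
  -- factors instead of unfolding the Cauchy product.
  record Series : Set c where
    no-eta-equality
    field coeff : ℕ → R.Carrier
  open Series public

  infix 4 _≈_
  -- A record, so that f and g can be inferred from the type f ≈ g.
  record _≈_ (f g : Series) : Set ℓ where
    constructor mk≈
    field at : ∀ n → coeff f n R.≈ coeff g n
  open _≈_ public

  infixl 7 _*_
  infixl 6 _+_
  infix  8 -_

  const : R.Carrier → Series
  coeff (const a) zero    = a
  coeff (const a) (suc n) = R.0#

  0# 1# X : Series
  coeff 0# n = R.0#
  coeff 1# zero    = R.1#
  coeff 1# (suc n) = R.0#
  coeff X zero          = R.0#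
  coeff X (suc zero)    = R.1#
  coeff X (suc (suc n)) = R.0#

  _+_ _*_ : Series → Series → Series
  coeff (f + g) n = coeff f n R.+ coeff g n
  coeff (f * g) n = ∑[ i ≤ n ] (coeff f (toℕ i) R.* coeff g (n ∸ toℕ i))

  -_ : Series → Series
  coeff (- f) n = R.- coeff f n

  rawRing : RawRing c ℓ
  rawRing = record { Carrier = Series ; _≈_ = _≈_ ; _+_ = _+_ ; _*_ = _*_ ; -_ = -_ ; 0# = 0# ; 1# = 1# }

  tail : Series → Series
  coeff (tail f) n = coeff f (suc n)

  -- By definition coeff (f * g) (suc n) is
  -- coeff f 0 * coeff g (suc n) + coeff (tail f * g) n.

  *-local : ∀ f f′ g g′ n → (∀ i → i ≤ n → coeff f i R.≈ coeff f′ i) →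
            (∀ i → i ≤ n → coeff g i R.≈ coeff g′ i) → coeff (f * g) n R.≈ coeff (f′ * g′) n
  *-local f f′ g g′ zero    p q = R.+-congʳ (R.*-cong (p 0 z≤n) (q 0 z≤n))
  *-local f f′ g g′ (suc n) p q = R.+-cong (R.*-cong (p 0 z≤n) (q (suc n) ℕ.≤-refl))
    (*-local (tail f) (tail f′) g g′ n (λ i i≤n → p (suc i) (s≤s i≤n)) (λ i i≤n → q i (ℕ.m≤n⇒m≤1+n i≤n)))

  *-head : ∀ f g → coeff (f * g) 0 R.≈ coeff f 0 R.* coeff g 0
  *-head f g = R.+-identityʳ _

  *-tailʳ : ∀ f g n → coeff (f * g) (suc n) R.≈ coeff (f * tail g) n R.+ coeff f (suc n) R.* coeff g 0
  *-tailʳ f g zero    = begin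
    coeff f 0 R.* coeff g 1 R.+ (coeff f 1 R.* coeff g 0 R.+ R.0#) ≈⟨ R.+-cong (R.sym (R.+-identityʳ _)) (R.+-identityʳ _) ⟩
    (coeff f 0 R.* coeff g 1 R.+ R.0#) R.+ coeff f 1 R.* coeff g 0 ∎
  *-tailʳ f g (suc n) = begin
    coeff f 0 R.* coeff g (2 ℕ.+ n) R.+ coeff (tail f * g) (suc n)
      ≈⟨ R.+-congˡ (*-tailʳ (tail f) g n) ⟩
    coeff f 0 R.* coeff g (2 ℕ.+ n) R.+ (coeff (tail f * tail g) n R.+ coeff f (2 ℕ.+ n) R.* coeff g 0)
      ≈⟨ R.+-assoc _ _ _ ⟨
    coeff (f * tail g) (suc n) R.+ coeff f (2 ℕ.+ n) R.* coeff g 0 ∎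

  *-vanish : ∀ f g n → (∀ i → coeff f i R.≈ R.0#) → coeff (f * g) n R.≈ R.0#
  *-vanish f g zero    p = R.trans (*-head f g) (R.trans (R.*-congʳ (p 0)) (R.zeroˡ _))
  *-vanish f g (suc n) p = begin
    coeff f 0 R.* coeff g (suc n) R.+ coeff (tail f * g) n
      ≈⟨ R.+-cong (R.trans (R.*-congʳ (p 0)) (R.zeroˡ _)) (*-vanish (tail f) g n (λ i → p (suc i))) ⟩
    R.0# R.+ R.0#
      ≈⟨ R.+-identityʳ _ ⟩
    R.0# ∎

  private
    scale : R.Carrier → Series → Series
    coeff (scale a f) n = a R.* coeff f n

    comm : ∀ f g n → coeff (f * g) n R.≈ coeff (g * f) n
    comm f g zero    = R.+-congʳ (R.*-comm _ _)
    comm f g (suc n) = begin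
      coeff f 0 R.* coeff g (suc n) R.+ coeff (tail f * g) n  ≈⟨ R.+-cong (R.*-comm _ _) (comm (tail f) g n) ⟩
      coeff g (suc n) R.* coeff f 0 R.+ coeff (g * tail f) n  ≈⟨ R.+-comm _ _ ⟩
      coeff (g * tail f) n R.+ coeff g (suc n) R.* coeff f 0  ≈⟨ *-tailʳ g f n ⟨
      coeff (g * f) (suc n)                                   ∎

    distribˡ : ∀ f g h n → coeff (f * (g + h)) n R.≈ coeff (f * g) n R.+ coeff (f * h) n
    distribˡ f g h zero    = begin
      coeff (f * (g + h)) 0                                        ≈⟨ *-head f (g + h) ⟩
      coeff f 0 R.* (coeff g 0 R.+ coeff h 0)                      ≈⟨ R.distribˡ _ _ _ ⟩
      coeff f 0 R.* coeff g 0 R.+ coeff f 0 R.* coeff h 0          ≈⟨ R.+-cong (*-head f g) (*-head f h) ⟨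
      coeff (f * g) 0 R.+ coeff (f * h) 0                          ∎
    distribˡ f g h (suc n) = R.trans
      (R.+-cong (R.distribˡ _ _ _) (distribˡ (tail f) g h n)) (+S.interchange _ _ _ _)

    distribʳ : ∀ f g h n → coeff ((g + h) * f) n R.≈ coeff (g * f) n R.+ coeff (h * f) n
    distribʳ f g h n = R.trans (comm (g + h) f n)
      (R.trans (distribˡ f g h n) (R.+-cong (comm f g n) (comm f h n)))

    scaleˡ : ∀ a f g n → coeff (scale a f * g) n R.≈ a R.* coeff (f * g) n
    scaleˡ a f g zero    = begin
      coeff (scale a f * g) 0               ≈⟨ *-head (scale a f) g ⟩
      (a R.* coeff f 0) R.* coeff g 0       ≈⟨ R.*-assoc _ _ _ ⟩
      a R.* (coeff f 0 R.* coeff g 0)       ≈⟨ R.*-congˡ (*-head f g) ⟨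
      a R.* coeff (f * g) 0                 ∎
    scaleˡ a f g (suc n) = R.trans
      (R.+-cong (R.*-assoc _ _ _) (scaleˡ a (tail f) g n)) (R.sym (R.distribˡ _ _ _))

    assoc : ∀ f g h n → coeff ((f * g) * h) n R.≈ coeff (f * (g * h)) n
    assoc f g h zero    = begin
      coeff ((f * g) * h) 0                        ≈⟨ R.trans (*-head (f * g) h) (R.*-congʳ (*-head f g)) ⟩
      (coeff f 0 R.* coeff g 0) R.* coeff h 0      ≈⟨ R.*-assoc _ _ _ ⟩
      coeff f 0 R.* (coeff g 0 R.* coeff h 0)      ≈⟨ R.trans (*-head f (g * h)) (R.*-congˡ (*-head g h)) ⟨
      coeff (f * (g * h)) 0                        ∎
    assoc f g h (suc n) = begin
      coeff (f * g) 0 R.* coeff h (suc n) R.+ coeff (tail (f * g) * h) n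
        ≈⟨ R.+-cong (R.trans (R.*-congʳ (*-head f g)) (R.*-assoc _ _ _))
             (R.trans (*-local (tail (f * g)) (scale (coeff f 0) (tail g) + tail f * g) h h n (λ _ _ → R.refl) (λ _ _ → R.refl))
             (R.trans (distribʳ h (scale (coeff f 0) (tail g)) (tail f * g) n)
               (R.+-cong (scaleˡ (coeff f 0) (tail g) h n) (assoc (tail f) g h n)))) ⟩
      coeff f 0 R.* (coeff g 0 R.* coeff h (suc n)) R.+ (coeff f 0 R.* coeff (tail g * h) n R.+ coeff (tail f * (g * h)) n)
        ≈⟨ R.+-assoc _ _ _ ⟨
      coeff f 0 R.* (coeff g 0 R.* coeff h (suc n)) R.+ coeff f 0 R.* coeff (tail g * h) n R.+ coeff (tail f * (g * h)) n
        ≈⟨ R.+-congʳ (R.distribˡ _ _ _) ⟨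
      coeff (f * (g * h)) (suc n) ∎

    identityˡ : ∀ f n → coeff (1# * f) n R.≈ coeff f n
    identityˡ f zero    = R.trans (*-head 1# f) (R.*-identityˡ _)
    identityˡ f (suc n) = begin
      R.1# R.* coeff f (suc n) R.+ coeff (tail 1# * f) n ≈⟨ R.+-cong (R.*-identityˡ _) (*-vanish (tail 1#) f n (λ _ → R.refl)) ⟩
      coeff f (suc n) R.+ R.0#                           ≈⟨ R.+-identityʳ _ ⟩
      coeff f (suc n)                                    ∎

  isCommutativeRing : IsCommutativeRing _≈_ _+_ _*_ -_ 0# 1#
  isCommutativeRing = record
    { isRing = record
      { +-isAbelianGroup = record
        { isGroup = record
          { isMonoid = record
            { isSemigroup = record
              { isMagma = record
                { isEquivalence = record
                  { refl  = mk≈ λ n → R.refl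
                  ; sym   = λ p → mk≈ λ n → R.sym (at p n)
                  ; trans = λ p q → mk≈ λ n → R.trans (at p n) (at q n)
                  }
                ; ∙-cong = λ p q → mk≈ λ n → R.+-cong (at p n) (at q n)
                }
              ; assoc = λ f g h → mk≈ λ n → R.+-assoc _ _ _
              }
            ; identity = (λ f → mk≈ λ n → R.+-identityˡ _) , (λ f → mk≈ λ n → R.+-identityʳ _)
            }
          ; inverse = (λ f → mk≈ λ n → R.-‿inverseˡ _) , (λ f → mk≈ λ n → R.-‿inverseʳ _)
          ; ⁻¹-cong = λ p → mk≈ λ n → R.-‿cong (at p n)
          }
        ; comm = λ f g → mk≈ λ n → R.+-comm _ _
        }
      ; *-cong = λ {f} {f′} {g} {g′} p q → mk≈ λ n → *-local f f′ g g′ n (λ i _ → at p i) (λ i _ → at q i)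
      ; *-assoc = λ f g h → mk≈ (assoc f g h)
      ; *-identity = (λ f → mk≈ (identityˡ f)) , (λ f → mk≈ λ n → R.trans (comm f 1# n) (identityˡ f n))
      ; distrib = (λ f g h → mk≈ (distribˡ f g h)) , (λ f g h → mk≈ (distribʳ f g h))
      }
    ; *-comm = λ f g → mk≈ (comm f g)
    }

  commutativeRing : CommutativeRing c ℓ
  commutativeRing = record { isCommutativeRing = isCommutativeRing }

_⟦t⟧ : ∀ {c ℓ} → IntegralDomain c ℓ → IntegralDomain c ℓ
D ⟦t⟧ = record
  { commutativeRing   = commutativeRing
  ; 1≉0               = λ 1≈0 → D.1≉0 (at 1≈0 0)
  ; *-cancelˡ-nonZero = NoZeroDivisors.almostCancel commutativeRing noZeroDivisors
  ; ≈-stable          = λ f g ¬¬f≈g → mk≈ λ n → D.≈-stable _ _ λ fn≉gn → ¬¬f≈g λ f≈g → fn≉gn (at f≈g n)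
  }
  where
  module D = IntegralDomain D
  open PowerSeries D.commutativeRing

  -- If m is least with coeff f m ≉ 0, then coeff (f * g) (m + n) is a
  -- nonzero multiple of coeff g n as soon as g vanishes below n.
  lead : ∀ m f g n → (∀ i → i < m → coeff f i D.≈ D.0#) → (∀ j → j < n → coeff g j D.≈ D.0#) →
         coeff (f * g) (m ℕ.+ n) D.≈ coeff f m D.* coeff g n
  lead zero    f g zero    p q = *-head f g
  lead zero    f g (suc n) p q = D.trans
    (D.+-congˡ (D.trans (at (CommutativeRing.*-comm commutativeRing (tail f) g) n)
      (D.trans (*-local g 0# (tail f) (tail f) n (λ j j≤n → q j (s≤s j≤n)) (λ _ _ → D.refl))
        (*-vanish 0# (tail f) n (λ _ → D.refl)))))
    (D.+-identityʳ _)
  lead (suc m) f g n       p q = D.trans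
    (D.+-cong (D.trans (D.*-congʳ (p 0 z<s)) (D.zeroˡ _))
              (lead m (tail f) g n (λ i i<m → p (suc i) (s<s i<m)) q))
    (D.+-identityˡ _)

  noZeroDivisors : ∀ f g → ¬ (f ≈ 0#) → f * g ≈ 0# → g ≈ 0#
  noZeroDivisors f g f≉0 fg≈0 = mk≈ λ n → D.≈-stable _ _ λ gn≉0 →
    f≉0 (mk≈ (<-rec _ λ m f≈0-below → D.≈-stable _ _ λ fm≉0 →
      gn≉0 (<-rec (λ n → coeff g n D.≈ D.0#) (λ k g≈0-below →
        NoZeroDivisors.noZeroDivisors D.commutativeRing D.*-cancelˡ-nonZero (coeff f m) (coeff g k) fm≉0
          (D.trans (D.sym (lead m f g k (λ i i<m → f≈0-below i<m) (λ j j<k → g≈0-below j<k)))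
                   (at fg≈0 (m ℕ.+ k)))) n)))

module Polynomials {c ℓ} (R : CommutativeRing c ℓ) where
  private
    module R = CommutativeRing R
    module S = PowerSeries R
    module SR = CommutativeRing S.commutativeRing

  FinitelySupported : S.Series → Set ℓ
  FinitelySupported f = ∃ λ N → ∀ n → N ≤ n → S.coeff f n R.≈ R.0#

  -- The finite support is a proof that equality ignores.
  record Polynomial : Set (c ⊔ˡ ℓ) where
    no-eta-equality
    field
      series : S.Series
      finite : FinitelySupported series
  open Polynomial public

  infix 4 _≈_
  record _≈_ (p q : Polynomial) : Set ℓ where
    constructor mk≈
    field series-≈ : series p S.≈ series q
  open _≈_ public

  infixl 7 _*_
  infixl 6 _+_
  infix  8 -_

  private
    +-finite : ∀ f g → FinitelySupported f → FinitelySupported g → FinitelySupported (f S.+ g)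
    +-finite f g (N , p) (M , q) = N ⊔ M , λ n l → R.trans
      (R.+-cong (p n (ℕ.m⊔n≤o⇒m≤o N M l)) (q n (ℕ.m⊔n≤o⇒n≤o N M l))) (R.+-identityʳ _)

    *-vanish-beyond : ∀ N M f g → (∀ n → N ≤ n → S.coeff f n R.≈ R.0#) → (∀ n → M ≤ n → S.coeff g n R.≈ R.0#) →
                      ∀ n → N ℕ.+ M ≤ n → S.coeff (f S.* g) n R.≈ R.0#
    *-vanish-beyond zero    M f g p q n       _       = S.*-vanish f g n (λ i → p i z≤n)
    *-vanish-beyond (suc N) M f g p q (suc n) (s≤s l) = R.trans
      (R.+-cong (R.trans (R.*-congˡ (q (suc n) (ℕ.≤-trans (ℕ.m≤n+m M N) (ℕ.m≤n⇒m≤1+n l)))) (R.zeroʳ _))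
                (*-vanish-beyond N M (S.tail f) g (λ i N≤i → p (suc i) (s≤s N≤i)) q n l))
      (R.+-identityʳ _)

    *-finite : ∀ f g → FinitelySupported f → FinitelySupported g → FinitelySupported (f S.* g)
    *-finite f g (N , p) (M , q) = N ℕ.+ M , *-vanish-beyond N M f g p q

    -‿finite : ∀ f → FinitelySupported f → FinitelySupported (S.- f)
    -‿finite f (N , p) = N , λ n l → R.trans (R.-‿cong (p n l)) (RingProperties.-0#≈0# R.ring)

  const : R.Carrier → Polynomial
  series (const a) = S.const a
  finite (const a) = 1 , λ { (suc n) _ → R.refl }

  0# 1# X : Polynomial
  series 0# = S.0#
  finite 0# = 0 , λ n _ → R.refl
  series 1# = S.1#
  finite 1# = 1 , λ { (suc n) _ → R.refl }
  series X = S.X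
  finite X = 2 , λ { (suc zero) (s≤s ()) ; (suc (suc n)) _ → R.refl }

  _+_ _*_ : Polynomial → Polynomial → Polynomial
  series (p + q) = series p S.+ series q
  finite (p + q) = +-finite (series p) (series q) (finite p) (finite q)
  series (p * q) = series p S.* series q
  finite (p * q) = *-finite (series p) (series q) (finite p) (finite q)

  -_ : Polynomial → Polynomial
  series (- p) = S.- series p
  finite (- p) = -‿finite (series p) (finite p)

  rawRing : RawRing (c ⊔ˡ ℓ) ℓ
  rawRing = record { Carrier = Polynomial ; _≈_ = _≈_ ; _+_ = _+_ ; _*_ = _*_ ; -_ = -_ ; 0# = 0# ; 1# = 1# }

  series-isRingMonomorphism : IsRingMonomorphism rawRing S.rawRing series
  series-isRingMonomorphism = record
    { isRingHomomorphism = record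
      { isSemiringHomomorphism = record
        { isNearSemiringHomomorphism = record
          { +-isMonoidHomomorphism = record
            { isMagmaHomomorphism = record
              { isRelHomomorphism = record { cong = series-≈ }
              ; homo = λ _ _ → SR.refl
              }
            ; ε-homo = SR.refl
            }
          ; *-homo = λ _ _ → SR.refl
          }
        ; 1#-homo = SR.refl
        }
      ; -‿homo = λ _ → SR.refl
      }
    ; injective = mk≈
    }

  commutativeRing : CommutativeRing (c ⊔ˡ ℓ) ℓ
  commutativeRing = record
    { isCommutativeRing = RingMonomorphism.isCommutativeRing series-isRingMonomorphism S.isCommutativeRing }

_[X] : ∀ {c ℓ} → IntegralDomain c ℓ → IntegralDomain (c ⊔ˡ ℓ) ℓ
D [X] = record
  { commutativeRing   = commutativeRing
  ; 1≉0               = λ 1≈0 → D⟦t⟧.1≉0 (series-≈ 1≈0)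
  ; *-cancelˡ-nonZero = λ p q r p≉0 pq≈pr → mk≈ (D⟦t⟧.*-cancelˡ-nonZero (series p) (series q) (series r)
                          (λ p≈0 → p≉0 (mk≈ p≈0)) (series-≈ pq≈pr))
  ; ≈-stable          = λ p q ¬¬p≈q → mk≈ (D⟦t⟧.≈-stable _ _ λ p≉q → ¬¬p≈q λ p≈q → p≉q (series-≈ p≈q))
  }
  where
  module D⟦t⟧ = IntegralDomain (D ⟦t⟧)
  open Polynomials (IntegralDomain.commutativeRing D)

module SquareRoot {c ℓ} (R : CommutativeRing c ℓ) (half : CommutativeRing.Carrier R)
                  (half+half≈1 : CommutativeRing._≈_ R (CommutativeRing._+_ R half half) (CommutativeRing.1# R)) where
  private
    module R = CommutativeRing R
    module +S = CommutativeSemigroupProperties R.+-commutativeSemigroup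
  open PowerSeries R
  open import Relation.Binary.Reasoning.Setoid R.setoid

  -- For f with constant term 1: √ f = 1 + u, where u has constant term 0 and
  -- u ≈ half * (f - 1 - u * u);
  -- iterating this equation k times from 0 gives the terms of u up to degree k.

  private
    step : Series → Series → Series
    coeff (step f u) n = half R.* (coeff f n R.- (coeff 1# n R.+ coeff (u * u) n))

    approx : Series → ℕ → Series
    approx f zero    = 0#
    approx f (suc k) = step f (approx f k)

    limit : Series → Series
    coeff (limit f) n = coeff (approx f n) n

  √_ : Series → Series
  √ f = 1# + limit f

  private
    double-half : ∀ a → half R.* a R.+ half R.* a R.≈ a
    double-half a = R.trans (R.sym (R.distribʳ a half half))
                   (R.trans (R.*-congʳ half+half≈1) (R.*-identityˡ a))

    drop-0ˡ : ∀ {a b c} → a R.≈ R.0# → a R.* b R.+ c R.≈ c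
    drop-0ˡ a≈0 = R.trans (R.+-congʳ (R.trans (R.*-congʳ a≈0) (R.zeroˡ _))) (R.+-identityˡ _)

    drop-0ʳ : ∀ {a b c} → b R.≈ R.0# → c R.+ a R.* b R.≈ c
    drop-0ʳ b≈0 = R.trans (R.+-congˡ (R.trans (R.*-congˡ b≈0) (R.zeroʳ _))) (R.+-identityʳ _)

    square-0 : ∀ u → coeff u 0 R.≈ R.0# → coeff (u * u) 0 R.≈ R.0#
    square-0 u u0≈0 = drop-0ˡ u0≈0

    square-1 : ∀ u → coeff u 0 R.≈ R.0# → coeff (u * u) 1 R.≈ R.0#
    square-1 u u0≈0 = R.trans (drop-0ˡ u0≈0) (R.trans (R.+-comm _ _) (drop-0ʳ u0≈0))

    square-2+ : ∀ u n → coeff u 0 R.≈ R.0# → coeff (u * u) (suc (suc n)) R.≈ coeff (tail u * tail u) n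
    square-2+ u n u0≈0 = R.trans (drop-0ˡ u0≈0) (R.trans (*-tailʳ (tail u) u n) (drop-0ʳ u0≈0))

    square-local : ∀ u v k → coeff u 0 R.≈ R.0# → coeff v 0 R.≈ R.0# → (∀ i → i ≤ k → coeff u i R.≈ coeff v i) →
                   ∀ i → i ≤ suc k → coeff (u * u) i R.≈ coeff (v * v) i
    square-local u v k u0 v0 p zero          l = R.trans (square-0 u u0) (R.sym (square-0 v v0))
    square-local u v k u0 v0 p (suc zero)    l = R.trans (square-1 u u0) (R.sym (square-1 v v0))
    square-local u v k u0 v0 p (suc (suc i)) (s≤s l) = begin
      coeff (u * u) (suc (suc i)) ≈⟨ square-2+ u i u0 ⟩
      coeff (tail u * tail u) i   ≈⟨ *-local (tail u) (tail v) (tail u) (tail v) i tail-p tail-p ⟩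
      coeff (tail v * tail v) i   ≈⟨ square-2+ v i v0 ⟨
      coeff (v * v) (suc (suc i)) ∎
      where
      tail-p : ∀ j → j ≤ i → coeff u (suc j) R.≈ coeff v (suc j)
      tail-p j j≤i = p (suc j) (ℕ.≤-trans (s≤s j≤i) l)

    step-cong : ∀ f u v n → coeff (u * u) n R.≈ coeff (v * v) n → coeff (step f u) n R.≈ coeff (step f v) n
    step-cong f u v n p = R.*-congˡ (R.+-congˡ (R.-‿cong (R.+-congˡ p)))

    module _ (f : Series) (f0≈1 : coeff f 0 R.≈ R.1#) where

      approx-0 : ∀ k → coeff (approx f k) 0 R.≈ R.0#
      approx-0 zero    = R.refl
      approx-0 (suc k) = begin
        half R.* (coeff f 0 R.- (R.1# R.+ coeff (u * u) 0)) ≈⟨ R.*-congˡ (R.+-cong f0≈1 (R.-‿cong (R.+-congˡ (square-0 u (approx-0 k))))) ⟩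
        half R.* (R.1# R.- (R.1# R.+ R.0#))                 ≈⟨ R.*-congˡ (R.+-congˡ (R.-‿cong (R.+-identityʳ _))) ⟩
        half R.* (R.1# R.- R.1#)                            ≈⟨ R.*-congˡ (R.-‿inverseʳ _) ⟩
        half R.* R.0#                                       ≈⟨ R.zeroʳ _ ⟩
        R.0#                                                ∎
        where u = approx f k

      approx-suc : ∀ k i → i ≤ k → coeff (approx f k) i R.≈ coeff (approx f (suc k)) i
      approx-suc zero    zero z≤n = R.sym (approx-0 1)
      approx-suc (suc k) i    l   = step-cong f (approx f k) (approx f (suc k)) i
        (square-local (approx f k) (approx f (suc k)) k (approx-0 k) (approx-0 (suc k)) (approx-suc k) i l)

      approx-limit : ∀ k i → i ≤ k → coeff (approx f k) i R.≈ coeff (limit f) i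
      approx-limit zero    zero z≤n = R.refl
      approx-limit (suc k) i    l   with ℕ.m≤n⇒m<n∨m≡n l
      ... | inj₁ (s≤s i≤k) = R.trans (R.sym (approx-suc k i i≤k)) (approx-limit k i i≤k)
      ... | inj₂ ≡.refl    = R.refl

      limit-step : ∀ n → coeff (limit f) n R.≈ coeff (step f (limit f)) n
      limit-step n = R.trans (approx-suc n n ℕ.≤-refl)
        (step-cong f (approx f n) (limit f) n
          (*-local (approx f n) (limit f) (approx f n) (limit f) n (approx-limit n) (approx-limit n)))

  √-constant-term : ∀ f → coeff (√ f) 0 R.≈ R.1#
  √-constant-term f = R.+-identityʳ R.1#

  √-square : ∀ f → coeff f 0 R.≈ R.1# → (√ f) * (√ f) ≈ f
  √-square f f0≈1 = mk≈ λ n → let a = coeff 1# n ; w = coeff u n ; s = coeff (u * u) n in begin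
    coeff ((1# + u) * (1# + u)) n               ≈⟨ at expand n ⟩
    (a R.+ w) R.+ (w R.+ s)                     ≈⟨ R.+-assoc a w (w R.+ s) ⟩
    a R.+ (w R.+ (w R.+ s))                     ≈⟨ R.+-congˡ (R.+-assoc w w s) ⟨
    a R.+ ((w R.+ w) R.+ s)                     ≈⟨ R.+-congˡ (R.+-congʳ (R.trans (R.+-cong (fix n) (fix n)) (double-half _))) ⟩
    a R.+ ((coeff f n R.- (a R.+ s)) R.+ s)     ≈⟨ +S.x∙yz≈y∙xz a _ s ⟩
    (coeff f n R.- (a R.+ s)) R.+ (a R.+ s)     ≈⟨ R.+-assoc _ _ _ ⟩
    coeff f n R.+ (R.- (a R.+ s) R.+ (a R.+ s)) ≈⟨ R.+-congˡ (R.-‿inverseˡ _) ⟩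
    coeff f n R.+ R.0#                          ≈⟨ R.+-identityʳ _ ⟩
    coeff f n                                   ∎
    where
    module S = CommutativeRing commutativeRing
    u = limit f
    fix = limit-step f f0≈1
    expand : (1# + u) * (1# + u) ≈ (1# + u) + (u + u * u)
    expand = S.trans (S.distribʳ (1# + u) 1# u)
      (S.+-cong (S.*-identityˡ _) (S.trans (S.distribˡ u 1# u) (S.+-congʳ (S.*-identityʳ u))))

module FractionField {c ℓ} (D : IntegralDomain c ℓ) where
  private
    module D = IntegralDomain D

  record Fraction : Set (c ⊔ˡ ℓ) where
    constructor _/_⟨_⟩
    field
      num     : D.Carrier
      den     : D.Carrier
      den≉0   : den D.≉ D.0#

  infix  7 _/_⟨_⟩
  infixl 6 _-_
  infix  4 _≈_

  _≈_ : Fraction → Fraction → Set ℓ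
  (a / b ⟨ _ ⟩) ≈ (a′ / b′ ⟨ _ ⟩) = a D.* b′ D.≈ a′ D.* b

  ι : D.Carrier → Fraction
  ι a = a / D.1# ⟨ D.1≉0 ⟩

  _-_ : Fraction → Fraction → Fraction
  (a / b ⟨ b≉0 ⟩) - (a′ / b′ ⟨ b′≉0 ⟩) = (a D.* b′ D.- a′ D.* b) / (b D.* b′) ⟨ *-nonZero D b≉0 b′≉0 ⟩

ℚ[x] ℚ[x,y] ℚ[x,y]⟦t⟧ : IntegralDomain 0ℓ 0ℓ
ℚ[x]       = ℚ-domain [X]
ℚ[x,y]     = ℚ[x] [X]
ℚ[x,y]⟦t⟧  = ℚ[x,y] ⟦t⟧

module ℚ[x]       = IntegralDomain ℚ[x]
module ℚ[x,y]     = IntegralDomain ℚ[x,y]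
module ℚ[x,y]⟦t⟧  = IntegralDomain ℚ[x,y]⟦t⟧
module Frac       = FractionField ℚ[x,y]⟦t⟧

module Pˣ = Polynomials (IntegralDomain.commutativeRing ℚ-domain)
module Pʸ = Polynomials ℚ[x].commutativeRing
module Sᵗ = PowerSeries ℚ[x,y].commutativeRing

-- ℚ[x,y] is ℚ[x][y]; a subscript ₚ marks its elements, as opposed to the
-- corresponding constant power series in t.

xₚ yₚ ½ₚ : ℚ[x,y].Carrier
xₚ = Pʸ.const Pˣ.X
yₚ = Pʸ.X
½ₚ = Pʸ.const (Pˣ.const ½)

½ₚ+½ₚ≈1 : ½ₚ ℚ[x,y].+ ½ₚ ℚ[x,y].≈ ℚ[x,y].1#
½ₚ+½ₚ≈1 = Pʸ.mk≈ (Sᵗ′.mk≈ λ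
  { zero    → Pˣ.mk≈ (Sᵗ″.mk≈ λ { zero → ≡.refl ; (suc n) → ≡.refl })
  ; (suc n) → Pˣ.mk≈ (Sᵗ″.mk≈ λ _ → ≡.refl)
  })
  where
  module Sᵗ′ = PowerSeries ℚ[x].commutativeRing
  module Sᵗ″ = PowerSeries ℚ.+-*-commutativeRing

open SquareRoot ℚ[x,y].commutativeRing ½ₚ ½ₚ+½ₚ≈1 public

x y t : ℚ[x,y]⟦t⟧.Carrier
x = Sᵗ.const xₚ
y = Sᵗ.const yₚ
t = Sᵗ.X

A : ℚ[x,y]⟦t⟧.Carrier
Sᵗ.coeff A n = foldr _+_ 0# (map (λ σ → yₚ ^ des σ * xₚ ^ (321′ -mch) σ) (𝒮[ n ] 123′))
  where
  open ℚ[x,y]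
  open Exp semiring using (_^_)
  123′ 321′ : Word
  123′ = 1 ∷ 2 ∷ 3 ∷ []
  321′ = 3 ∷ 2 ∷ 1 ∷ []

module Formula where
  open ℚ[x,y]⟦t⟧
  open Exp semiring using (_^_)
  open Mult +-monoid using () renaming (_×_ to _·_)

  radicand numerator denominator : Carrier
  radicand = 4 · x ^ 2 * t ^ 2 * y ^ 2 - 4 · x * t * y - 4 · t ^ 2 * y + 1#

  numerator =
      2 · (x - 1#) ^ 2 * t ^ 6 * y ^ 3 * (x ^ 2 * y - 1#) ^ 2
    + t ^ 2 * (- (x ^ 2) * (2 · x + 5 · 1#) * y ^ 2 + (6 · x + 2 · 1#) * y - 1#)
    + 2 · t ^ 4 * y * ( (2 · 1# - 3 · x) * x ^ 4 * y ^ 3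
                      + (3 · x ^ 2 + 2 · x - 2 · 1#) * x ^ 2 * y ^ 2
                      - (3 · x ^ 2 + x - 1#) * y + 1# )
    + 2 · (x - 1#) * t ^ 5 * y ^ 2 * (x ^ 5 * y ^ 3 - 3 · x ^ 4 * y ^ 2 + 4 · x ^ 2 * y - x * y - 1#)
    + 2 · t ^ 3 * y * (3 · x ^ 4 * y ^ 2 - x ^ 3 * y - 5 · x ^ 2 * y + x + 2 · 1#)
    + t * (4 · x * y - 2 · 1#)
    - 1#
    + (t * (x * y - 1#) - 1#) ^ 2 * √ radicand

  denominator = 2 · t * y ^ 2 * (- (x ^ 2) * t * y + x + t) ^ 3

  private
    module C = ℚ[x,y]

    -- A record, so that f can be inferred from the type Vanishes f.
    record Vanishes (f : Carrier) : Set where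
      constructor vanishes
      field at0 : Sᵗ.coeff f 0 C.≈ C.0#

    *-vanishˡ : ∀ {f g} → Vanishes f → Vanishes (f * g)
    *-vanishˡ {f} {g} (vanishes f0≈0) = vanishes (C.trans (Sᵗ.*-head f g)
      (C.trans (C.*-congʳ f0≈0) (C.zeroˡ (Sᵗ.coeff g 0))))

    *-vanishʳ : ∀ {f g} → Vanishes g → Vanishes (f * g)
    *-vanishʳ {f} {g} (vanishes g0≈0) = vanishes (C.trans (Sᵗ.*-head f g)
      (C.trans (C.*-congˡ g0≈0) (C.zeroʳ (Sᵗ.coeff f 0))))

    +-vanish : ∀ {f g} → Vanishes f → Vanishes g → Vanishes (f + g)
    +-vanish (vanishes f0≈0) (vanishes g0≈0) = vanishes (C.trans (C.+-cong f0≈0 g0≈0) (C.+-identityʳ C.0#))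

    -‿vanish : ∀ {f} → Vanishes f → Vanishes (- f)
    -‿vanish (vanishes f0≈0) = vanishes (C.trans (C.-‿cong f0≈0) (RingProperties.-0#≈0# C.ring))

    ·-vanish : ∀ k {f} → Vanishes f → Vanishes (k · f)
    ·-vanish zero    _ = vanishes C.refl
    ·-vanish (suc k) v = +-vanish v (·-vanish k v)

    t-vanishes : Vanishes t
    t-vanishes = vanishes C.refl

    t²-vanishes : Vanishes (t ^ 2)
    t²-vanishes = *-vanishˡ t-vanishes

    +1-constant-term : ∀ {f} → Vanishes f → Sᵗ.coeff (f + 1#) 0 C.≈ C.1#
    +1-constant-term (vanishes f0≈0) = C.trans (C.+-congʳ f0≈0) (C.+-identityˡ C.1#)

    vanishing-part : Vanishes (4 · x ^ 2 * t ^ 2 * y ^ 2 - 4 · x * t * y - 4 · t ^ 2 * y)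
    vanishing-part = +-vanish
      (+-vanish (*-vanishˡ (*-vanishʳ t²-vanishes)) (-‿vanish (*-vanishˡ (*-vanishʳ t-vanishes))))
      (-‿vanish (*-vanishˡ (·-vanish 4 t²-vanishes)))

  radicand-constant-term : Sᵗ.coeff radicand 0 C.≈ C.1#
  radicand-constant-term = +1-constant-term vanishing-part

  √radicand-constant-term : Sᵗ.coeff (√ radicand) 0 C.≈ C.1#
  √radicand-constant-term = √-constant-term radicand

  √radicand-square : √ radicand * √ radicand ≈ radicand
  √radicand-square = √-square radicand radicand-constant-term

  private
    -- Coefficients in t, then y, then x.
    coeff³ : Carrier → ℕ → ℕ → ℕ → ℚ
    coeff³ f i j k = PowerSeries.coeff (Pˣ.series (PowerSeries.coeff (Pʸ.series (Sᵗ.coeff f i)) j)) k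

    nonZero : ∀ f i j k → ¬ coeff³ f i j k ≡ ℚ.0ℚ → f ≉ 0#
    nonZero f i j k fᵢⱼₖ≢0 f≈0 = fᵢⱼₖ≢0
      (PowerSeries.at (Pˣ.series-≈ (PowerSeries.at (Pʸ.series-≈ (Sᵗ.at f≈0 i)) j)) k)

  denominator≉0 : denominator ≉ 0#
  denominator≉0 = *-nonZero ℚ[x,y]⟦t⟧ (*-nonZero ℚ[x,y]⟦t⟧
    (nonZero (2 · t) 1 0 0 λ ())
    (^-nonZero ℚ[x,y]⟦t⟧ 2 (nonZero y 0 1 0 λ ())))
    (^-nonZero ℚ[x,y]⟦t⟧ 3 (nonZero (- (x ^ 2) * t * y + x + t) 0 0 1 λ ()))

open Formula public

{-# OPTIONS --safe #-}
module Submission where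

-- A 123-avoiding permutation is built by prepending letters. If n is its length
-- and m the largest letter that begins an ascending pair (m = 0 if there is
-- none), then the admissible new letters are m + 1, …, n + 1. The letter n + 1
-- keeps m, any other letter becomes the new m, so k = n − m together with
-- two bits (is the first letter the maximum? is there a descent at the start?)
-- determines all further growth and its weight in x and y. Let M k, P k, Q k be
-- the generating functions of the extensions of such a permutation (maximum
-- first; not maximum first and starting with an ascent; not maximum first and
-- starting with a descent). With D = t + x − tx²y, κ = tyD and
-- g = (1 − txy)(1 − x), the sequence X k = D · P k + g satisfies
-- X (k+1) − X k = κ X (k+2). If V and V′ are the roots of z² − z + κ and V′ has
-- constant term 0, then E k = V X (k+1) − X k satisfies E k = V′ E (k+1), hence
-- is divisible by every power of t and vanishes. This replaces the kernel method.
-- The relations at k = 0 then give V² · M 1 = 1 + t − txy, and A is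
-- an explicit combination of M 1 with polynomials, up to the factor D.

open import Algebra.Bundles using (CommutativeRing)
import Algebra.Properties.CommutativeSemigroup as CommutativeSemigroupProperties
import Algebra.Properties.Monoid.Mult as ℕMult
import Algebra.Properties.Ring as RingProperties
import Algebra.Properties.Semiring.Exp as Exp
import Algebra.Properties.Semiring.Mult.TCOptimised as Mult
import Algebra.Solver.Ring as RingSolver
open import Algebra.Solver.Ring.AlmostCommutativeRing using (fromCommutativeRing; _-Raw-AlmostCommutative⟶_)
open import Data.Bool.Base using (Bool; true; false; if_then_else_)
open import Data.Integer.Base as ℤ using (ℤ; +_; -[1+_]; _⊖_)
import Data.Integer.Properties as ℤ
open import Data.List.Base using (List; []; _∷_; _++_; length; map; filter; foldr; take; tails; zip; concatMap; upTo)
open import Data.List.Membership.Propositional using (_∈_; lose)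
open import Data.List.Membership.Propositional.Properties
open import Data.List.Membership.Propositional.Properties.WithK using (unique∧set⇒bag)
import Data.List.Properties as List
open import Data.List.Relation.Binary.BagAndSetEquality using (∼bag⇒↭)
open import Data.List.Relation.Binary.Permutation.Propositional as ↭ using (_↭_)
open import Data.List.Relation.Binary.Sublist.Propositional using (_⊆_; []; _∷_; _∷ʳ_; from∈; minimum)
open import Data.List.Relation.Binary.Sublist.Propositional.Properties using (map⁺; All-resp-⊆)
open import Data.List.Relation.Unary.All as All using (All; []; _∷_)
import Data.List.Relation.Unary.All.Properties as All
open import Data.List.Relation.Unary.AllPairs as AllPairs using (AllPairs; []; _∷_)
import Data.List.Relation.Unary.AllPairs.Properties as AllPairs
open import Data.List.Relation.Unary.Any using (here; there)
open import Data.List.Relation.Unary.Unique.DecPropositional using (unique?)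
open import Data.List.Relation.Unary.Unique.Propositional using (Unique)
import Data.List.Relation.Unary.Unique.Propositional.Properties as Unique
open import Data.Maybe.Base using (Maybe; just; nothing)
open import Data.Nat.Base as ℕ using (ℕ; zero; suc; pred; _≤_; _<_; z≤n; s≤s)
open import Data.Nat.Induction using (<-rec)
import Data.Nat.Properties as ℕ
open import Data.Product.Base using (∃; ∃₂; _×_; _,_; proj₁; proj₂)
open import Data.Sum.Base using (_⊎_; inj₁; inj₂)
open import Function.Base using (_∘_; _on_; _∋_)
open import Function.Bundles using (mk⇔)
open import Relation.Binary.PropositionalEquality as ≡ using (_≡_; _≢_)
open import Relation.Nullary using (¬_; Dec; yes; no; does; contradiction)
open import Relation.Nullary.Decidable using (dec-true; dec-false)

open import Defs

-- A ring solver with integer coefficients over an arbitrary commutative ring.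

module IntegerSolver {c ℓ} (R : CommutativeRing c ℓ) where
  open CommutativeRing R
  open RingProperties ring
  open Mult semiring using (1+×; ×-homo-+; ×1-homo-*) renaming (_×_ to _·_)
  open import Relation.Binary.Reasoning.Setoid setoid

  -- The optimised multiple `1 · 1#` computes to `1#`, so the solver constant 1 evaluates to `1#`
  -- itself.
  fromℤ : ℤ → Carrier
  fromℤ (+ n)    = n · 1#
  fromℤ -[1+ n ] = - (suc n · 1#)

  private
    fromℤ-neg : ∀ i → fromℤ (ℤ.- i) ≈ - fromℤ i
    fromℤ-neg (+ zero)   = sym -0#≈0#
    fromℤ-neg (+ suc n)  = refl
    fromℤ-neg -[1+ n ]   = sym (-‿involutive _)

    cancel-suc : ∀ a b → (1# + a) - (1# + b) ≈ a - b
    cancel-suc a b = begin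
      (1# + a) - (1# + b)     ≈⟨ +-cong (+-comm 1# a) (sym (-‿+-comm 1# b)) ⟩
      (a + 1#) + (- 1# - b)   ≈⟨ +-assoc a 1# _ ⟩
      a + (1# + (- 1# - b))   ≈⟨ +-congˡ (+-assoc 1# (- 1#) (- b)) ⟨
      a + ((1# - 1#) - b)     ≈⟨ +-congˡ (+-congʳ (-‿inverseʳ 1#)) ⟩
      a + (0# - b)            ≈⟨ +-congˡ (+-identityˡ _) ⟩
      a - b                   ∎

    fromℤ-⊖ : ∀ m n → fromℤ (m ⊖ n) ≈ m · 1# - n · 1#
    fromℤ-⊖ m       zero    = sym (trans (+-congˡ -0#≈0#) (+-identityʳ _))
    fromℤ-⊖ zero    (suc n) = sym (+-identityˡ _)
    fromℤ-⊖ (suc m) (suc n) = begin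
      fromℤ (suc m ⊖ suc n)             ≡⟨ ≡.cong fromℤ (ℤ.[1+m]⊖[1+n]≡m⊖n m n) ⟩
      fromℤ (m ⊖ n)                     ≈⟨ fromℤ-⊖ m n ⟩
      m · 1# - n · 1#                   ≈⟨ cancel-suc _ _ ⟨
      (1# + m · 1#) - (1# + n · 1#)     ≈⟨ +-cong (1+× m 1#) (-‿cong (1+× n 1#)) ⟨
      suc m · 1# - suc n · 1#           ∎

    fromℤ-+ : ∀ i j → fromℤ (i ℤ.+ j) ≈ fromℤ i + fromℤ j
    fromℤ-+ (+ m)    (+ n)    = ×-homo-+ 1# m n
    fromℤ-+ (+ m)    -[1+ n ] = fromℤ-⊖ m (suc n)
    fromℤ-+ -[1+ m ] (+ n)    = trans (fromℤ-⊖ n (suc m)) (+-comm _ _)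
    fromℤ-+ -[1+ m ] -[1+ n ] = begin
      - (suc (suc (m ℕ.+ n)) · 1#)        ≡⟨ ≡.cong (λ k → - (k · 1#)) (≡.cong suc (ℕ.+-suc m n)) ⟨
      - ((suc m ℕ.+ suc n) · 1#)          ≈⟨ -‿cong (×-homo-+ 1# (suc m) (suc n)) ⟩
      - (suc m · 1# + suc n · 1#)         ≈⟨ -‿+-comm _ _ ⟨
      - (suc m · 1#) - suc n · 1#         ∎

    fromℤ-ℕ* : ∀ m j → fromℤ (+ m ℤ.* j) ≈ m · 1# * fromℤ j
    fromℤ-ℕ* m (+ n)    = trans (reflexive (≡.cong fromℤ (≡.sym (ℤ.pos-* m n)))) (×1-homo-* m n)
    fromℤ-ℕ* m -[1+ n ] = begin
      fromℤ (+ m ℤ.* -[1+ n ])         ≡⟨ ≡.cong fromℤ (≡.trans (≡.cong ℤ.-_ (ℤ.pos-* m (suc n))) (ℤ.neg-distribʳ-* (+ m) (+ suc n))) ⟨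
      fromℤ (ℤ.- (+ (m ℕ.* suc n)))    ≈⟨ fromℤ-neg (+ (m ℕ.* suc n)) ⟩
      - ((m ℕ.* suc n) · 1#)           ≈⟨ -‿cong (×1-homo-* m (suc n)) ⟩
      - (m · 1# * suc n · 1#)          ≈⟨ -‿distribʳ-* _ _ ⟩
      m · 1# * - (suc n · 1#)          ∎

    fromℤ-* : ∀ i j → fromℤ (i ℤ.* j) ≈ fromℤ i * fromℤ j
    fromℤ-* (+ m)    j = fromℤ-ℕ* m j
    fromℤ-* -[1+ m ] j = begin
      fromℤ (-[1+ m ] ℤ.* j)            ≡⟨ ≡.cong fromℤ (ℤ.neg-distribˡ-* (+ suc m) j) ⟨
      fromℤ (ℤ.- (+ suc m ℤ.* j))       ≈⟨ fromℤ-neg (+ suc m ℤ.* j) ⟩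
      - fromℤ (+ suc m ℤ.* j)           ≈⟨ -‿cong (fromℤ-ℕ* (suc m) j) ⟩
      - (suc m · 1# * fromℤ j)          ≈⟨ -‿distribˡ-* _ _ ⟩
      - (suc m · 1#) * fromℤ j          ∎

    fromℤ-homomorphism : ℤ.+-*-rawRing -Raw-AlmostCommutative⟶ fromCommutativeRing R
    fromℤ-homomorphism = record
      { ⟦_⟧    = fromℤ
      ; +-homo = fromℤ-+
      ; *-homo = fromℤ-*
      ; -‿homo = fromℤ-neg
      ; 0-homo = refl
      ; 1-homo = refl
      }

    fromℤ-≟ : ∀ i j → Maybe (fromℤ i ≈ fromℤ j)
    fromℤ-≟ i j with i ℤ.≟ j
    ... | yes i≡j = just (reflexive (≡.cong fromℤ i≡j))
    ... | no  _   = nothing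

  open RingSolver ℤ.+-*-rawRing (fromCommutativeRing R) fromℤ-homomorphism fromℤ-≟ public

-- The recurrences of the tree and their solution, in an arbitrary commutative ring.

module KernelMethod {c ℓ} (R : CommutativeRing c ℓ) where
  open CommutativeRing R
  open RingProperties ring
  open IntegerSolver R
  open Exp semiring using (_^_)
  open ℕMult +-monoid using () renaming (_×_ to _·_)
  open import Relation.Binary.Reasoning.Setoid setoid

  infixr 9 _:·_
  -- Unfolds exactly like `_·_`, trailing zero included, so that evaluated solver terms coincide
  -- with the formulas.
  _:·_ : ∀ {n} → ℕ → Polynomial n → Polynomial n
  zero  :· p = con (+ 0)
  suc k :· p = p :+ k :· p

  :1 : ∀ {n} → Polynomial n
  :1 = con (+ 1)

  :0 : ∀ {n} → Polynomial n
  :0 = con (+ 0)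

  -- Solver syntax for `D`, `κ`, `g`, `p` and `radical`, for identities that depend on their
  -- definitions.
  :D :κ :g :p :radical : ∀ {n} (x y t : Polynomial n) → Polynomial n
  :D x y t = t :+ x :- t :* x :^ 2 :* y
  :κ x y t = t :* y :* :D x y t
  :g x y t = (:1 :- t :* x :* y) :* (:1 :- x)
  :p x y t = :1 :+ t :- t :* x :* y
  :radical x y t = 4 :· x :^ 2 :* t :^ 2 :* y :^ 2 :- 4 :· x :* t :* y :- 4 :· t :^ 2 :* y :+ :1

  -- The sum starts at index 1: prepending one of the letters m + 1, ..., n changes k = n - m into
  -- one of k, ..., 1.
  partialSum : (ℕ → Carrier) → ℕ → Carrier
  partialSum f zero    = 0#
  partialSum f (suc k) = f (suc k) + partialSum f k

  -- A goal a ≈ b is derived from relations lᵢ ≈ rᵢ by letting the solver verify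
  -- a ≈ b + c₁ * (l₁ - r₁) + …, and then absorbing the summands from the last to the first.
  absorb : ∀ {a l r} c → l ≈ r → a + c * (l - r) ≈ a
  absorb {a} {l} {r} c l≈r = begin
    a + c * (l - r)   ≈⟨ +-congˡ (*-congˡ (x≈y⇒x∙y⁻¹≈ε l≈r)) ⟩
    a + c * 0#        ≈⟨ +-congˡ (zeroʳ c) ⟩
    a + 0#            ≈⟨ +-identityʳ a ⟩
    a                 ∎

  module _ (x y t : Carrier) where

    D κ g p : Carrier
    D = t + x - t * x ^ 2 * y
    κ = t * y * D
    g = (1# - t * x * y) * (1# - x)
    p = 1# + t - t * x * y

    -- The discriminant 1 - 4κ of z² - z + κ.
    radical : Carrier
    radical = 4 · x ^ 2 * t ^ 2 * y ^ 2 - 4 · x * t * y - 4 · t ^ 2 * y + 1#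

    module Tree
      (M P Q : ℕ → Carrier)
      (M-rec : ∀ k → M k ≈ 1# + t * (x * y * M (suc k) + partialSum P k))
      (P-rec : ∀ k → P k ≈ 1# + t * (y * (M (suc k) + partialSum Q k)))
      (Q-rec : ∀ k → Q k ≈ 1# + t * (x * y * (M (suc k) + partialSum Q k)))
      where

      -- The recurrence for `P` alone has the constant solution -g/D. Subtracting it makes the
      -- recurrence homogeneous, and the factor `D` avoids the division.
      X : ℕ → Carrier
      X k = D * P k + g

      -- When the maximum is not first, every admissible letter makes a descent, which completes a
      -- 321-match exactly if there was a descent at the start. So `Q-rec` is `P-rec` with an extra
      -- x, that is, Q - 1 = x(P - 1).
      Q≈ : ∀ k → Q k ≈ x * P k + (1# - x)
      Q≈ k = begin
        Q k                                     ≈⟨ Q-rec k ⟩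
        1# + t * (x * y * B)                    ≈⟨ solve 4 (λ x y t B →
          :1 :+ t :* (x :* y :* B) := x :* (:1 :+ t :* (y :* B)) :+ (:1 :- x)) refl x y t B ⟩
        x * (1# + t * (y * B)) + (1# - x)       ≈⟨ +-congʳ (*-congˡ (P-rec k)) ⟨
        x * P k + (1# - x)                      ∎
        where B = M (suc k) + partialSum Q k

      -- Consecutive partial sums differ in one term, so differences remove the sums; `Q≈` then
      -- eliminates `Q`.
      ΔP : ∀ k → P (suc k) ≈ P k + t * y * (M (2 ℕ.+ k) - M (suc k) + (x * P (suc k) + (1# - x)))
      ΔP k = begin
        P (suc k)                                                       ≈⟨ P-rec (suc k) ⟩
        1# + t * (y * (m₂ + (Q (suc k) + σ)))                           ≈⟨ solve 6 (λ y t m₁ m₂ q σ →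
          :1 :+ t :* (y :* (m₂ :+ (q :+ σ))) := :1 :+ t :* (y :* (m₁ :+ σ)) :+ t :* y :* (m₂ :- m₁ :+ q)) refl y t m₁ m₂ (Q (suc k)) σ ⟩
        1# + t * (y * (m₁ + σ)) + t * y * (m₂ - m₁ + Q (suc k))         ≈⟨ +-cong (P-rec k) (*-congˡ (+-congˡ (sym (Q≈ (suc k))))) ⟨
        P k + t * y * (m₂ - m₁ + (x * P (suc k) + (1# - x)))            ∎
        where
        m₁ = M (suc k)
        m₂ = M (2 ℕ.+ k)
        σ  = partialSum Q k

      ΔM : ∀ k → M (suc k) - M k ≈ t * (x * y * (M (2 ℕ.+ k) - M (suc k)) + P (suc k))
      ΔM k = begin
        M (suc k) - M k                                                           ≈⟨ +-cong (M-rec (suc k)) (-‿cong (M-rec k)) ⟩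
        1# + t * (x * y * m₂ + (p₁ + σ)) - (1# + t * (x * y * m₁ + σ))            ≈⟨ solve 7 (λ x y t m₁ m₂ p₁ σ →
          :1 :+ t :* (x :* y :* m₂ :+ (p₁ :+ σ)) :- (:1 :+ t :* (x :* y :* m₁ :+ σ)) := t :* (x :* y :* (m₂ :- m₁) :+ p₁))
          refl x y t m₁ m₂ p₁ σ ⟩
        t * (x * y * (m₂ - m₁) + p₁)                                              ∎
        where
        m₁ = M (suc k)
        m₂ = M (2 ℕ.+ k)
        p₁ = P (suc k)
        σ  = partialSum P k

      -- `ΔM` at k + 1 and `ΔP` at k + 1 eliminate the differences of `M` from `ΔP` at k, which
      -- leaves a second-order recurrence for `P`.
      X-rec : ∀ k → X (suc k) ≈ X k + κ * X (2 ℕ.+ k)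
      X-rec k = begin
        X (suc k)
          ≈⟨ solve 8 (λ x y t p₀ p₁ p₂ m₁ m₂ → let D = :D x y t ; g = :g x y t in
               D :* p₁ :+ g := D :* p₀ :+ g :+ t :* y :* D :* (D :* p₂ :+ g)
                 :+ D :* (p₁ :- (p₀ :+ t :* y :* (m₁ :+ (x :* p₁ :+ (:1 :- x)))))
                 :+ D :* (t :* y) :* (m₁ :- t :* (x :* y :* m₂ :+ p₂))
                 :+ :- (D :* (t :* x :* y)) :* (p₂ :- (p₁ :+ t :* y :* (m₂ :+ (x :* p₂ :+ (:1 :- x))))))
               refl x y t (P k) (P (suc k)) (P (2 ℕ.+ k)) (M (2 ℕ.+ k) - M (suc k)) (M (3 ℕ.+ k) - M (2 ℕ.+ k)) ⟩
        _ ≈⟨ absorb _ (ΔP (suc k)) ⟩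
        _ ≈⟨ absorb _ (ΔM (suc k)) ⟩
        _ ≈⟨ absorb _ (ΔP k) ⟩
        X k + κ * X (2 ℕ.+ k)   ∎

      -- At k = 1 the partial sums are single terms, so `M 2` can be eliminated between `M-rec` and
      -- `P-rec`.
      M₁≈X₁ : M 1 ≈ X 1
      M₁≈X₁ = begin
        M 1
          ≈⟨ solve 7 (λ x y t m₁ m₂ p₁ q₁ →
               m₁ := :D x y t :* p₁ :+ :g x y t
                 :+ :1 :* (m₁ :- (:1 :+ t :* (x :* y :* m₂ :+ (p₁ :+ :0))))
                 :+ :- x :* (p₁ :- (:1 :+ t :* (y :* (m₂ :+ (q₁ :+ :0)))))
                 :+ :- (t :* x :* y) :* (q₁ :- (x :* p₁ :+ (:1 :- x))))
               refl x y t (M 1) (M 2) (P 1) (Q 1) ⟩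
        _ ≈⟨ absorb _ (Q≈ 1) ⟩
        _ ≈⟨ absorb _ (P-rec 1) ⟩
        _ ≈⟨ absorb _ (M-rec 1) ⟩
        X 1 ∎

      -- For nonempty permutations k is positive, but the recurrences extend to k = 0, where they
      -- give P 0 = 1 + ty · M 1. The constant `p` is D + g.
      X₀≈ : X 0 ≈ p + κ * X 1
      X₀≈ = begin
        X 0
          ≈⟨ solve 6 (λ x y t m₁ p₀ X₁ →
               :D x y t :* p₀ :+ :g x y t := :p x y t :+ :κ x y t :* X₁
                 :+ :D x y t :* (p₀ :- (:1 :+ t :* (y :* (m₁ :+ :0))))
                 :+ :κ x y t :* (m₁ :- X₁))
               refl x y t (M 1) (P 0) (X 1) ⟩
        _ ≈⟨ absorb _ M₁≈X₁ ⟩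
        _ ≈⟨ absorb _ (P-rec 0) ⟩
        p + κ * X 1 ∎

      module Annihilation (V V′ : Carrier) (V+V′≈1 : V + V′ ≈ 1#) (VV′≈κ : V * V′ ≈ κ) where

        E : ℕ → Carrier
        E k = V * X (suc k) - X k

        -- With S the shift of the index, `X-rec` reads (1 - V′S)(1 - VS)X = 0, and E is -(1 - VS)X.
        E-rec : ∀ k → E k ≈ V′ * E (suc k)
        E-rec k = begin
          E k
            ≈⟨ solve 6 (λ V V′ κ X₀ X₁ X₂ →
                 V :* X₁ :- X₀ := V′ :* (V :* X₂ :- X₁)
                   :+ X₁ :* (V :+ V′ :- :1)
                   :+ :- X₂ :* (V :* V′ :- κ)
                   :+ :1 :* (X₁ :- (X₀ :+ κ :* X₂)))
                 refl V V′ κ (X k) (X (suc k)) (X (2 ℕ.+ k)) ⟩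
          _ ≈⟨ absorb _ (X-rec k) ⟩
          _ ≈⟨ absorb _ VV′≈κ ⟩
          _ ≈⟨ absorb _ V+V′≈1 ⟩
          V′ * E (suc k) ∎

        -- E 0 = 0 and `X₀≈` give (V - κ) · X 1 = p, where V - κ = V(1 - V′) = V². Multiplication by
        -- V′² then replaces V²V′² by κ².
        M₁-closed : E 0 ≈ 0# → κ * κ * M 1 ≈ V′ * V′ * p
        M₁-closed E₀≈0 = begin
          κ * κ * M 1
            ≈⟨ solve 7 (λ V V′ κ p m₁ X₀ X₁ →
                 κ :* κ :* m₁ := V′ :* V′ :* p
                   :+ κ :* κ :* (m₁ :- X₁)
                   :+ :- (X₁ :* (κ :+ V :* V′ :+ V′ :* V′)) :* (V :* V′ :- κ)
                   :+ V :* V′ :* V′ :* X₁ :* (V :+ V′ :- :1)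
                   :+ V′ :* V′ :* (V :* X₁ :- X₀ :- :0)
                   :+ V′ :* V′ :* (X₀ :- (p :+ κ :* X₁)))
                 refl V V′ κ p (M 1) (X 0) (X 1) ⟩
          _ ≈⟨ absorb _ X₀≈ ⟩
          _ ≈⟨ absorb _ E₀≈0 ⟩
          _ ≈⟨ absorb _ V+V′≈1 ⟩
          _ ≈⟨ absorb _ VV′≈κ ⟩
          _ ≈⟨ absorb _ M₁≈X₁ ⟩
          V′ * V′ * p ∎

      -- The relations at k = 1 express `F` through `P 1`, and D · P 1 = M 1 - g; hence the factor
      -- `D`.
      D*A : ∀ A F → A ≈ 1# + t * F → F ≈ 1# + t * (y * M 2 + partialSum P 1) →
            A * D ≈ D * (1# - t ^ 2 * y * (1# - x)) + t * p * (M 1 - g)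
      D*A A F A≈ F≈ = begin
        A * D
          ≈⟨ solve 9 (λ x y t A F m₁ m₂ p₁ q₁ → let D = :D x y t ; g = :g x y t ; p = :p x y t in
               A :* D := D :* (:1 :- t :^ 2 :* y :* (:1 :- x)) :+ t :* p :* (m₁ :- g)
                 :+ D :* (A :- (:1 :+ t :* F))
                 :+ D :* t :* (F :- (:1 :+ t :* (y :* m₂ :+ (p₁ :+ :0))))
                 :+ :- (D :* t) :* (p₁ :- (:1 :+ t :* (y :* (m₂ :+ (q₁ :+ :0)))))
                 :+ :- (D :* t :* (t :* y)) :* (q₁ :- (x :* p₁ :+ (:1 :- x)))
                 :+ :- (t :* p) :* (m₁ :- (D :* p₁ :+ g)))
               refl x y t A F (M 1) (M 2) (P 1) (Q 1) ⟩
        _ ≈⟨ absorb _ M₁≈X₁ ⟩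
        _ ≈⟨ absorb _ (Q≈ 1) ⟩
        _ ≈⟨ absorb _ (P-rec 1) ⟩
        _ ≈⟨ absorb _ F≈ ⟩
        _ ≈⟨ absorb _ A≈ ⟩
        D * (1# - t ^ 2 * y * (1# - x)) + t * p * (M 1 - g) ∎

    module HalfRoots (s h : Carrier) (h+h≈1 : h + h ≈ 1#) (s²≈ : s * s ≈ radical) where

      V V′ : Carrier
      V  = h * (1# + s)
      V′ = h * (1# - s)

      V+V′≈1 : V + V′ ≈ 1#
      V+V′≈1 = trans (solve 2 (λ s h → h :* (:1 :+ s) :+ h :* (:1 :- s) := h :+ h) refl s h) h+h≈1

      VV′≈κ : V * V′ ≈ κ
      VV′≈κ = begin
        V * V′
          ≈⟨ solve 5 (λ x y t s h →
               h :* (:1 :+ s) :* (h :* (:1 :- s)) := :κ x y t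
                 :+ :- (h :* h) :* (s :* s :- :radical x y t)
                 -- This is κ(4h² - 1), factored so that `h+h≈1` absorbs it.
                 :+ :κ x y t :* (h :+ h :+ :1) :* (h :+ h :- :1))
               refl x y t s h ⟩
        _ ≈⟨ absorb _ h+h≈1 ⟩
        _ ≈⟨ absorb _ s²≈ ⟩
        κ ∎

      -- As a root of z² - z + κ, `V′` satisfies 2V′² = 2V′ - 2κ, and 2V′ = 1 - s.
      V′² : 2 · (V′ * V′) ≈ 1# - 2 · κ - s
      V′² = begin
        2 · (V′ * V′)
          ≈⟨ solve 5 (λ x y t s h → let κ = :κ x y t in
               2 :· (h :* (:1 :- s) :* (h :* (:1 :- s))) := :1 :- 2 :· κ :- s
                 :+ 2 :· (h :* h) :* (s :* s :- :radical x y t)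
                 :+ (:1 :- 2 :· κ :- s) :* (h :+ h :+ :1) :* (h :+ h :- :1))
               refl x y t s h ⟩
        _ ≈⟨ absorb _ h+h≈1 ⟩
        _ ≈⟨ absorb _ s²≈ ⟩
        1# - 2 · κ - s ∎

-- Coefficients of power series.

module SeriesLemmas {c ℓ} (R : CommutativeRing c ℓ) where
  private
    module R = CommutativeRing R
    module KR = KernelMethod R
  open PowerSeries R
  private
    module S = CommutativeRing commutativeRing
    module KS = KernelMethod commutativeRing
  open import Relation.Binary.Reasoning.Setoid R.setoid

  coeff-const-* : ∀ a f n → coeff (const a * f) n R.≈ a R.* coeff f n
  coeff-const-* a f zero    = *-head (const a) f
  coeff-const-* a f (suc n) = R.trans (R.+-congˡ (*-vanish (tail (const a)) f n (λ _ → R.refl))) (R.+-identityʳ _)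

  const-* : ∀ a b → const (a R.* b) ≈ const a * const b
  const-* a b = mk≈ λ
    { zero    → R.sym (coeff-const-* a (const b) 0)
    ; (suc n) → R.sym (R.trans (coeff-const-* a (const b) (suc n)) (R.zeroʳ a))
    }

  const-+ : ∀ a b → const (a R.+ b) ≈ const a + const b
  const-+ a b = mk≈ λ { zero → R.refl ; (suc n) → R.sym (R.+-identityʳ R.0#) }

  const-1 : const R.1# ≈ 1#
  const-1 = mk≈ λ { zero → R.refl ; (suc n) → R.refl }

  coeff-*-suc : ∀ f g n → coeff f 0 R.≈ R.0# → coeff (f * g) (suc n) R.≈ coeff (tail f * g) n
  coeff-*-suc f g n f0≈0 = R.trans (R.+-congʳ (R.trans (R.*-congʳ f0≈0) (R.zeroˡ _))) (R.+-identityˡ _)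

  coeff-X*-suc : ∀ f n → coeff (X * f) (suc n) R.≈ coeff f n
  coeff-X*-suc f n = begin
    coeff (X * f) (suc n)   ≈⟨ coeff-*-suc X f n R.refl ⟩
    coeff (tail X * f) n    ≈⟨ *-local (tail X) 1# f f n (λ { zero _ → R.refl ; (suc _) _ → R.refl }) (λ _ _ → R.refl) ⟩
    coeff (1# * f) n        ≈⟨ at (S.*-identityˡ f) n ⟩
    coeff f n               ∎

  ≈1+X* : ∀ f g → coeff f 0 R.≈ R.1# → (∀ n → coeff f (suc n) R.≈ coeff g n) → f ≈ 1# + X * g
  ≈1+X* f g f₀≈1 tail-f≈g = mk≈ λ
    { zero    → R.trans f₀≈1 (R.sym (R.trans (R.+-congˡ (R.trans (*-head X g) (R.zeroˡ _))) (R.+-identityʳ R.1#)))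
    ; (suc n) → R.trans (tail-f≈g n) (R.sym (R.trans (R.+-identityˡ _) (coeff-X*-suc g n)))
    }

  coeff-partialSum : ∀ f k n → coeff (KS.partialSum f k) n R.≈ KR.partialSum (λ j → coeff (f j) n) k
  coeff-partialSum f zero    n = R.refl
  coeff-partialSum f (suc k) n = R.+-congˡ (coeff-partialSum f k n)

  -- As v has no constant term, coefficient n of `v * f (suc k)` involves only coefficients of
  -- `f (suc k)` below n. The induction on n treats all k at once because k grows.
  contraction : ∀ v (f : ℕ → Series) → coeff v 0 R.≈ R.0# → (∀ k → f k ≈ v * f (suc k)) → ∀ k → f k ≈ 0#
  contraction v f v0≈0 f-rec k = mk≈ λ n → <-rec (λ n → ∀ k → coeff (f k) n R.≈ R.0#) below n k
    where
    below : ∀ n → (∀ {m} → m ℕ.< n → ∀ k → coeff (f k) m R.≈ R.0#) → ∀ k → coeff (f k) n R.≈ R.0#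
    below zero    ih k = begin
      coeff (f k) 0                            ≈⟨ at (f-rec k) 0 ⟩
      coeff (v * f (suc k)) 0                  ≈⟨ *-head v (f (suc k)) ⟩
      coeff v 0 R.* coeff (f (suc k)) 0        ≈⟨ R.*-congʳ v0≈0 ⟩
      R.0# R.* coeff (f (suc k)) 0             ≈⟨ R.zeroˡ _ ⟩
      R.0#                                     ∎
    below (suc n) ih k = begin
      coeff (f k) (suc n)                      ≈⟨ at (f-rec k) (suc n) ⟩
      coeff (v * f (suc k)) (suc n)            ≈⟨ coeff-*-suc v (f (suc k)) n v0≈0 ⟩
      coeff (tail v * f (suc k)) n             ≈⟨ *-local (tail v) (tail v) (f (suc k)) 0# n (λ _ _ → R.refl) (λ i i≤n → ih (s≤s i≤n) (suc k)) ⟩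
      coeff (tail v * 0#) n                    ≈⟨ at (S.zeroʳ (tail v)) n ⟩
      R.0#                                     ∎

-- The generating functions of the extensions.

module C = CommutativeRing ℚ[x,y].commutativeRing
module S = CommutativeRing ℚ[x,y]⟦t⟧.commutativeRing
open SeriesLemmas ℚ[x,y].commutativeRing
module KC = KernelMethod ℚ[x,y].commutativeRing
module KS = KernelMethod ℚ[x,y]⟦t⟧.commutativeRing

-- Whether the first letter is the maximum; the Boolean tells whether the
-- permutation starts with a descent. The singleton is top false.
data Kind : Set where
  top low : Bool → Kind

-- The kind after prepending a letter other than the new maximum. In front of a maximum it makes an
-- ascent; otherwise the first letter is m, which it exceeds, and it makes a descent.
next : Kind → Kind
next (top _) = low false
next (low _) = low true

-- The factor of a new descent at the front. It completes a 321-match exactly when the old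
-- permutation starts with a descent.
descentWeight : Bool → C.Carrier
descentWeight false = yₚ
descentWeight true  = xₚ C.* yₚ

startsWithDescent : Kind → Bool
startsWithDescent (top b) = b
startsWithDescent (low b) = b

-- The factors gained by prepending a new maximum, respectively another letter.
topWeight lowWeight : Kind → C.Carrier
topWeight κ       = descentWeight (startsWithDescent κ)
lowWeight (top _) = C.1#
lowWeight (low b) = descentWeight b

-- The total weight gained by prepending n letters in all admissible ways.
extensions : ℕ → Kind → ℕ → C.Carrier
extensions zero    κ k = C.1#
extensions (suc n) κ k =
  topWeight κ C.* extensions n (top true) (suc k) C.+ lowWeight κ C.* KC.partialSum (extensions n (next κ)) k

F : Kind → ℕ → S.Carrier
Sᵗ.coeff (F κ k) n = extensions n κ k

F-rec : ∀ κ k → F κ k S.≈ S.1# S.+ t S.* (Sᵗ.const (topWeight κ) S.* F (top true) (suc k)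
                                        S.+ Sᵗ.const (lowWeight κ) S.* KS.partialSum (F (next κ)) k)
F-rec κ k = ≈1+X* (F κ k) _ C.refl λ n → C.sym
  (C.+-cong (coeff-const-* (topWeight κ) (F (top true) (suc k)) n)
            (C.trans (coeff-const-* (lowWeight κ) (KS.partialSum (F (next κ)) k) n)
                     (C.*-congˡ (coeff-partialSum (F (next κ)) k n))))

M P Q : ℕ → S.Carrier
M = F (top true)
P = F (low false)
Q = F (low true)

open Sᵗ using (const)

M-rec : ∀ k → M k S.≈ S.1# S.+ t S.* (x S.* y S.* M (suc k) S.+ KS.partialSum P k)
M-rec k = S.trans (F-rec (top true) k) (S.+-congˡ (S.*-congˡ (S.+-cong
  (S.*-congʳ (const-* xₚ yₚ)) (S.trans (S.*-congʳ const-1) (S.*-identityˡ _)))))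

P-rec : ∀ k → P k S.≈ S.1# S.+ t S.* (y S.* (M (suc k) S.+ KS.partialSum Q k))
P-rec k = S.trans (F-rec (low false) k) (S.+-congˡ (S.*-congˡ (S.sym (S.distribˡ y (M (suc k)) _))))

Q-rec : ∀ k → Q k S.≈ S.1# S.+ t S.* (x S.* y S.* (M (suc k) S.+ KS.partialSum Q k))
Q-rec k = S.trans (F-rec (low true) k) (S.+-congˡ (S.*-congˡ
  (S.trans (S.sym (S.distribˡ (const (xₚ C.* yₚ)) (M (suc k)) _)) (S.*-congʳ (const-* xₚ yₚ)))))

-- The singleton has m = 0 and k = 1. A larger letter in front of it completes no 321-match, so its
-- factor is y, not xy.
singleton-rec : F (top false) 1 S.≈ S.1# S.+ t S.* (y S.* M 2 S.+ KS.partialSum P 1)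
singleton-rec = S.trans (F-rec (top false) 1) (S.+-congˡ (S.*-congˡ (S.+-congˡ
  (S.trans (S.*-congʳ const-1) (S.*-identityˡ _)))))

-- The generating tree of the 123-avoiding permutations.

module Generation where
  open import Data.Nat.Base using (_+_)
  open import Data.Nat.Properties using
    ( _≟_; _≤?_; _<?_; ≤-refl; ≤-trans; ≤-reflexive; ≤-antisym; ≤-pred; <-trans; <-irrefl; <-asym
    ; <⇒≤; <⇒≢; <⇒≱; ≤⇒≯; <-≤-trans; ≤∧≢⇒<; <-≤-connex; ≰⇒>; ≮⇒≥; n≤1+n; m≤n⇒m<n∨m≡n; m≤m+n
    ; +-suc; +-identityʳ; suc-injective )

  -- Prepending a turns each letter b ≥ a into b + 1; lower a undoes this on letters ≠ a.
  raise lower : ℕ → ℕ → ℕ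
  raise a b = if does (a ≤? b) then suc b else b
  lower a b = if does (a <? b) then pred b else b

  raise-≥ : ∀ {a b} → a ≤ b → raise a b ≡ suc b
  raise-≥ {a} {b} a≤b rewrite dec-true (a ≤? b) a≤b = ≡.refl

  raise-< : ∀ {a b} → b < a → raise a b ≡ b
  raise-< {a} {b} b<a rewrite dec-false (a ≤? b) (<⇒≱ b<a) = ≡.refl

  lower-> : ∀ {a b} → a < b → lower a b ≡ pred b
  lower-> {a} {b} a<b rewrite dec-true (a <? b) a<b = ≡.refl

  lower-≤ : ∀ {a b} → b ≤ a → lower a b ≡ b
  lower-≤ {a} {b} b≤a rewrite dec-false (a <? b) (≤⇒≯ b≤a) = ≡.refl

  raise-≢ : ∀ a b → a ≢ raise a b
  raise-≢ a b a≡ with <-≤-connex b a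
  ... | inj₁ b<a = <⇒≢ b<a (≡.sym (≡.trans a≡ (raise-< b<a)))
  ... | inj₂ a≤b = <⇒≢ (s≤s a≤b) (≡.trans a≡ (raise-≥ a≤b))

  raise-lower : ∀ {a b} → a ≢ b → raise a (lower a b) ≡ b
  raise-lower {a} {b} a≢b with <-≤-connex a b
  ... | inj₁ a<b@(s≤s a≤) = ≡.trans (≡.cong (raise a) (lower-> a<b)) (raise-≥ a≤)
  ... | inj₂ b≤a = ≡.trans (≡.cong (raise a) (lower-≤ b≤a)) (raise-< (≤∧≢⇒< b≤a (a≢b ∘ ≡.sym)))

  raise-inflates : ∀ a b → b ≤ raise a b
  raise-inflates a b with <-≤-connex b a
  ... | inj₁ b<a = ≤-reflexive (≡.sym (raise-< b<a))
  ... | inj₂ a≤b = ≤-trans (n≤1+n b) (≤-reflexive (≡.sym (raise-≥ a≤b)))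

  raise-≤-suc : ∀ a b → raise a b ≤ suc b
  raise-≤-suc a b with <-≤-connex b a
  ... | inj₁ b<a = ≤-trans (≤-reflexive (raise-< b<a)) (n≤1+n b)
  ... | inj₂ a≤b = ≤-reflexive (raise-≥ a≤b)

  raise-mono-< : ∀ a {b c} → b < c → raise a b < raise a c
  raise-mono-< a {b} {c} b<c with <-≤-connex b a
  ... | inj₁ b<a rewrite raise-< b<a = <-≤-trans b<c (raise-inflates a c)
  ... | inj₂ a≤b rewrite raise-≥ a≤b | raise-≥ (≤-trans a≤b (<⇒≤ b<c)) = s≤s b<c

  raise-cancel-< : ∀ a {b c} → raise a b < raise a c → b < c
  raise-cancel-< a {b} {c} rb<rc with <-≤-connex b c
  ... | inj₁ b<c = b<c
  ... | inj₂ c≤b with m≤n⇒m<n∨m≡n c≤b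
  ...   | inj₁ c<b  = contradiction rb<rc (<-asym (raise-mono-< a c<b))
  ...   | inj₂ ≡.refl = contradiction rb<rc (<-irrefl ≡.refl)

  raise-injective : ∀ a {b c} → raise a b ≡ raise a c → b ≡ c
  raise-injective a {b} {c} rb≡rc = ≤-antisym
    (≮⇒≥ λ c<b → <⇒≢ (raise-mono-< a c<b) (≡.sym rb≡rc))
    (≮⇒≥ λ b<c → <⇒≢ (raise-mono-< a b<c) rb≡rc)

  <raise⇒≤ : ∀ {a b} → a < raise a b → a ≤ b
  <raise⇒≤ {a} {b} a< with <-≤-connex b a
  ... | inj₁ b<a = contradiction (≡.subst (a <_) (raise-< b<a) a<) (<-asym b<a)
  ... | inj₂ a≤b = a≤b

  prepend : ℕ → Word → Word
  prepend a σ = a ∷ map (raise a) σ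

  prepend-injective : ∀ {a b σ τ} → prepend a σ ≡ prepend b τ → a ≡ b × σ ≡ τ
  prepend-injective {a} e with ≡.refl ← List.∷-injectiveˡ e = ≡.refl , List.map-injective (raise-injective a) (List.∷-injectiveʳ e)

  ⊆-map⁻ : ∀ (f : ℕ → ℕ) {τ} σ → τ ⊆ map f σ → ∃ λ ρ → ρ ⊆ σ × τ ≡ map f ρ
  ⊆-map⁻ f []      []       = [] , [] , ≡.refl
  ⊆-map⁻ f (b ∷ σ) (_ ∷ʳ s) with ρ , s′ , ≡.refl ← ⊆-map⁻ f σ s = ρ , b ∷ʳ s′ , ≡.refl
  ⊆-map⁻ f (b ∷ σ) (≡.refl ∷ s) with ρ , s′ , ≡.refl ← ⊆-map⁻ f σ s = b ∷ ρ , ≡.refl ∷ s′ , ≡.refl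

  -- The patterns 123 and 321 in terms of comparisons.

  123′ : Word
  123′ = 1 ∷ 2 ∷ 3 ∷ []

  321′ : Word
  321′ = 3 ∷ 2 ∷ 1 ∷ []

  ∷-injective₃ : ∀ {a b c a′ b′ c′} → (Word ∋ a ∷ b ∷ c ∷ []) ≡ a′ ∷ b′ ∷ c′ ∷ [] → a ≡ a′ × b ≡ b′ × c ≡ c′
  ∷-injective₃ ≡.refl = ≡.refl , ≡.refl , ≡.refl

  red-increasing⁺ : ∀ {a b c} → a < b → b < c → red (a ∷ b ∷ c ∷ []) ≡ 123′
  red-increasing⁺ {a} {b} {c} a<b b<c
    rewrite dec-true  (a ≤? a) ≤-refl | dec-false (b ≤? a) (<⇒≱ a<b) | dec-false (c ≤? a) (<⇒≱ (<-trans a<b b<c))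
          | dec-true  (a ≤? b) (<⇒≤ a<b) | dec-true  (b ≤? b) ≤-refl | dec-false (c ≤? b) (<⇒≱ b<c)
          | dec-true  (a ≤? c) (<⇒≤ (<-trans a<b b<c)) | dec-true (b ≤? c) (<⇒≤ b<c) | dec-true (c ≤? c) ≤-refl = ≡.refl

  red-decreasing⁺ : ∀ {a b c} → b < a → c < b → red (a ∷ b ∷ c ∷ []) ≡ 321′
  red-decreasing⁺ {a} {b} {c} b<a c<b
    rewrite dec-true  (a ≤? a) ≤-refl | dec-true (b ≤? a) (<⇒≤ b<a) | dec-true (c ≤? a) (<⇒≤ (<-trans c<b b<a))
          | dec-false (a ≤? b) (<⇒≱ b<a) | dec-true  (b ≤? b) ≤-refl | dec-true (c ≤? b) (<⇒≤ c<b)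
          | dec-false (a ≤? c) (<⇒≱ (<-trans c<b b<a)) | dec-false (b ≤? c) (<⇒≱ c<b) | dec-true (c ≤? c) ≤-refl = ≡.refl

  count≤ : ℕ → Word → ℕ
  count≤ a w = length (filter (_≤? a) w)

  private
    first≡1⇒< : ∀ a b c → count≤ a (a ∷ b ∷ c ∷ []) ≡ 1 → a < b
    first≡1⇒< a b c e with b ≤? a
    ... | no b≰a = ≰⇒> b≰a
    ... | yes b≤a rewrite dec-true (a ≤? a) ≤-refl | dec-true (b ≤? a) b≤a = contradiction e λ ()

    second≡2⇒< : ∀ a b c → a < b → count≤ b (a ∷ b ∷ c ∷ []) ≡ 2 → b < c
    second≡2⇒< a b c a<b e with c ≤? b
    ... | no c≰b = ≰⇒> c≰b
    ... | yes c≤b rewrite dec-true (a ≤? b) (<⇒≤ a<b) | dec-true (b ≤? b) ≤-refl | dec-true (c ≤? b) c≤b = contradiction e λ ()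

  red-increasing⁻ : ∀ {a b c} → red (a ∷ b ∷ c ∷ []) ≡ 123′ → a < b × b < c
  red-increasing⁻ {a} {b} {c} e with e₁ , e₂ , _ ← ∷-injective₃ e =
    let a<b = first≡1⇒< a b c e₁ in a<b , second≡2⇒< a b c a<b e₂

  private
    third≡1⇒> : ∀ a b c → count≤ c (a ∷ b ∷ c ∷ []) ≡ 1 → c < b
    third≡1⇒> a b c e with b ≤? c
    ... | no b≰c = ≰⇒> b≰c
    -- Both `b` and `c` are counted, so the count exceeds 1 whether or not `a` is counted.
    ... | yes b≤c with does (a ≤? c)
    ...   | true  rewrite dec-true (b ≤? c) b≤c | dec-true (c ≤? c) ≤-refl = contradiction e λ ()
    ...   | false rewrite dec-true (b ≤? c) b≤c | dec-true (c ≤? c) ≤-refl = contradiction e λ ()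

    second≡2⇒> : ∀ a b c → c < b → count≤ b (a ∷ b ∷ c ∷ []) ≡ 2 → b < a
    second≡2⇒> a b c c<b e with a ≤? b
    ... | no a≰b = ≰⇒> a≰b
    ... | yes a≤b rewrite dec-true (a ≤? b) a≤b | dec-true (b ≤? b) ≤-refl | dec-true (c ≤? b) (<⇒≤ c<b) = contradiction e λ ()

  red-decreasing⁻ : ∀ {a b c} → red (a ∷ b ∷ c ∷ []) ≡ 321′ → b < a × c < b
  red-decreasing⁻ {a} {b} {c} e with _ , e₂ , e₃ ← ∷-injective₃ e =
    let c<b = third≡1⇒> a b c e₃ in second≡2⇒> a b c c<b e₂ , c<b

  red-length : ∀ w {γ} → red w ≡ γ → length w ≡ length γ
  red-length w e = ≡.trans (≡.sym (List.length-map _ w)) (≡.cong length e)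

  -- Avoidance in terms of comparisons, which `raise` preserves and reflects.
  No123 : Word → Set
  No123 σ = ∀ {a b c} → a ∷ b ∷ c ∷ [] ⊆ σ → a < b → ¬ b < c

  avoids⇒No123 : ∀ {σ} → Avoids 123′ σ → No123 σ
  avoids⇒No123 av s a<b b<c = av (_ , s , red-increasing⁺ a<b b<c)

  No123⇒avoids : ∀ {σ} → No123 σ → Avoids 123′ σ
  No123⇒avoids free (τ , s , e) with τ | red-length τ e | e
  -- `red-length` leaves only words with three letters.
  ... | a ∷ b ∷ c ∷ [] | _ | e = let a<b , b<c = red-increasing⁻ e in free s a<b b<c

  -- Membership in `𝒮` and absence of repetitions in it.

  IsPermutation : ℕ → Word → Set
  IsPermutation n σ = length σ ≡ n × All (λ b → 1 ≤ b × b ≤ n) σ × Unique σ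

  ∈-words⁺ : ∀ {as} σ → All (_∈ as) σ → σ ∈ words (length σ) as
  ∈-words⁺ []      []           = here ≡.refl
  ∈-words⁺ (b ∷ σ) (b∈as ∷ σ⊆as) = ∈-cartesianProductWith⁺ _∷_ b∈as (∈-words⁺ σ σ⊆as)

  ∈-words⁻ : ∀ k {as σ} → σ ∈ words k as → length σ ≡ k × All (_∈ as) σ
  ∈-words⁻ zero    (here ≡.refl) = ≡.refl , []
  ∈-words⁻ (suc k) {as} σ∈ with b , τ , b∈as , τ∈ , ≡.refl ← ∈-cartesianProductWith⁻ _∷_ as (words k as) σ∈ =
    let ≡k , ⊆as = ∈-words⁻ k τ∈ in ≡.cong suc ≡k , b∈as ∷ ⊆as

  ∈-letters⁺ : ∀ {n b} → 1 ≤ b × b ≤ n → b ∈ map suc (upTo n)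
  ∈-letters⁺ (s≤s z≤n , b≤n) = ∈-map⁺ suc (∈-upTo⁺ b≤n)

  ∈-letters⁻ : ∀ {n b} → b ∈ map suc (upTo n) → 1 ≤ b × b ≤ n
  ∈-letters⁻ b∈ with c , c∈ , ≡.refl ← ∈-map⁻ suc b∈ = s≤s z≤n , ∈-upTo⁻ c∈

  ∈-𝒮⁺ : ∀ {n σ} → IsPermutation n σ → σ ∈ 𝒮 n
  ∈-𝒮⁺ {σ = σ} (≡.refl , letters , unique) = ∈-filter⁺ (unique? _≟_) (∈-words⁺ σ (All.map ∈-letters⁺ letters)) unique

  ∈-𝒮⁻ : ∀ {n σ} → σ ∈ 𝒮 n → IsPermutation n σ
  ∈-𝒮⁻ {n} σ∈ =
    let σ∈words , unique = ∈-filter⁻ (unique? _≟_) {xs = words n (map suc (upTo n))} σ∈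
        ≡n , letters = ∈-words⁻ n σ∈words
    in ≡n , All.map ∈-letters⁻ letters , unique

  words-unique : ∀ k {as} → Unique as → Unique (words k as)
  words-unique zero    _   = [] ∷ []
  words-unique (suc k) as! = Unique.cartesianProductWith⁺ _∷_ List.∷-injective as! (words-unique k as!)

  𝒮-avoiding-unique : ∀ n λ′ → Unique (𝒮[ n ] λ′)
  𝒮-avoiding-unique n λ′ = Unique.filter⁺ (avoids? λ′) (Unique.filter⁺ (unique? _≟_)
    (words-unique n (Unique.map⁺ suc-injective (Unique.upTo⁺ n))))

  -- m and k are as in the introduction: the length is m + k, and m + 1, …, m + k + 1 may be prepended.
  record Node : Set where
    constructor node
    field
      word : Word
      m k  : ℕ
      kind : Kind
  open Node

  -- Prepends m + 1, …, m + k in turn; the new length is always m + k + 1, so k decreases as m grows.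
  lowChildren : Word → Kind → ℕ → ℕ → List Node
  lowChildren σ κ m zero    = []
  lowChildren σ κ m (suc k) = node (prepend (suc m) σ) (suc m) (suc k) κ ∷ lowChildren σ κ (suc m) k

  topChild : Node → Node
  topChild (node σ m k κ) = node (prepend (suc (m + k)) σ) m (suc k) (top true)

  children : Node → List Node
  children ν = topChild ν ∷ lowChildren (word ν) (next (kind ν)) (m ν) (k ν)

  generation : ℕ → List Node
  generation zero    = node (1 ∷ []) 0 1 (top false) ∷ []
  generation (suc n) = concatMap children (generation n)

  -- The equation fixes the new length; as `j` is natural, it also bounds `a` by m + k.
  data LowChild (σ : Word) (κ : Kind) (m k : ℕ) : Node → Set where
    lowChild : ∀ {a j} → m < a → a + suc j ≡ suc (m + k) → LowChild σ κ m k (node (prepend a σ) a (suc j) κ)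

  lowChildren-All : ∀ σ κ m k → All (LowChild σ κ m k) (lowChildren σ κ m k)
  lowChildren-All σ κ m zero    = []
  lowChildren-All σ κ m (suc k) = lowChild ≤-refl ≡.refl ∷ All.map shift (lowChildren-All σ κ (suc m) k)
    where
    shift : ∀ {ν} → LowChild σ κ (suc m) k ν → LowChild σ κ m (suc k) ν
    shift (lowChild m<a e) = lowChild (<-trans ≤-refl m<a) (≡.trans e (≡.cong suc (≡.sym (+-suc m k))))

  ∈-lowChildren : ∀ σ κ m k {a} → m < a → a ≤ m + k → ∃ λ ν → ν ∈ lowChildren σ κ m k × word ν ≡ prepend a σ
  ∈-lowChildren σ κ m zero    m<a a≤ = contradiction (≤-trans a≤ (≤-reflexive (+-identityʳ m))) (<⇒≱ m<a)
  ∈-lowChildren σ κ m (suc k) m<a a≤ with m≤n⇒m<n∨m≡n m<a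
  ... | inj₂ ≡.refl = _ , here ≡.refl , ≡.refl
  ... | inj₁ m<a′ =
    let ν , ν∈ , e = ∈-lowChildren σ κ (suc m) k m<a′ (≤-trans a≤ (≤-reflexive (+-suc m k))) in ν , there ν∈ , e

  -- The invariant of the nodes.

  initialDescent : Word → Bool
  initialDescent (a ∷ b ∷ _) = does (b <? a)
  initialDescent _           = false

  headLetter : Kind → ℕ → ℕ → ℕ
  headLetter (top _) m k = m + k
  headLetter (low _) m k = m

  -- `decreasing` and `ascent` together characterise m as the largest letter that begins an
  -- ascending pair. The first shows that admissible letters create no 123, the second that no other
  -- letter is possible. `starts` and `descent` determine the weights.
  record Valid (ν : Node) : Set where
    open Node ν renaming (word to σ; m to m′; k to k′; kind to κ)
    field
      permutation : IsPermutation (m′ + k′) σ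
      no123       : No123 σ
      decreasing  : ∀ {b c} → b ∷ c ∷ [] ⊆ σ → m′ < b → ¬ b < c
      ascent      : m′ ≡ 0 ⊎ (∃ λ c → m′ ∷ c ∷ [] ⊆ σ × m′ < c)
      max∈        : m′ + k′ ∈ σ
      starts      : ∃ λ ρ → σ ≡ headLetter κ m′ k′ ∷ ρ
      descent     : initialDescent σ ≡ startsWithDescent κ

  prepend-permutation : ∀ {n a σ} → IsPermutation n σ → 1 ≤ a → a ≤ suc n → IsPermutation (suc n) (prepend a σ)
  prepend-permutation {n} {a} {σ} (≡n , letters , unique) 1≤a a≤ =
      ≡.cong suc (≡.trans (List.length-map (raise a) σ) ≡n)
    , (1≤a , a≤) ∷ All.map⁺ (All.map
        (λ {b} (1≤b , b≤n) → ≤-trans 1≤b (raise-inflates a b) , ≤-trans (raise-≤-suc a b) (s≤s b≤n)) letters)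
    , All.map⁺ (All.universal (raise-≢ a) σ) ∷ Unique.map⁺ (raise-injective a) unique

  module _ {σ m k κ} (valid : Valid (node σ m k κ)) {a} (m<a : m < a) where
    open Valid valid

    -- An occurrence within the raised word pulls back to `σ`. One that begins with `a` yields an
    -- ascending pair of `σ` whose first letter is at least a > m, against `decreasing`.
    prepend-no123 : No123 (prepend a σ)
    prepend-no123 (_ ∷ʳ s) b<c c<d with (_ ∷ _ ∷ _ ∷ []) , s′ , ≡.refl ← ⊆-map⁻ (raise a) σ s =
      no123 s′ (raise-cancel-< a b<c) (raise-cancel-< a c<d)
    prepend-no123 (≡.refl ∷ s) a<b b<c with (_ ∷ _ ∷ []) , s′ , ≡.refl ← ⊆-map⁻ (raise a) σ s =
      decreasing s′ (<-≤-trans m<a (<raise⇒≤ a<b)) (raise-cancel-< a b<c)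

  bounded : ∀ {n σ τ} → IsPermutation n σ → τ ⊆ σ → All (_≤ n) τ
  bounded (_ , letters , _) s = All-resp-⊆ s (All.map proj₂ letters)

  -- The new maximum begins no ascending pair and raises no letter, so m stays.
  topChild-valid : ∀ {ν} → Valid ν → Valid (topChild ν)
  topChild-valid {node σ m k κ} valid = record
    { permutation = ≡.subst (λ n → IsPermutation n (prepend a σ)) (≡.sym (+-suc m k)) perm′
    ; no123       = prepend-no123 valid m<a
    ; decreasing  = decreasing′
    ; ascent      = ascent′ ascent
    ; max∈        = here (+-suc m k)
    ; starts      = _ , ≡.cong (_∷ map (raise a) σ) (≡.sym (+-suc m k))
    ; descent     = descent′ starts
    }
    where
    open Valid valid
    a = suc (m + k)
    m<a = s≤s (m≤m+n m k)
    perm′ = prepend-permutation permutation (s≤s z≤n) ≤-refl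
    decreasing′ : ∀ {b c} → b ∷ c ∷ [] ⊆ prepend a σ → m < b → ¬ b < c
    decreasing′ s@(≡.refl ∷ _) _ b<c with _ ∷ c≤ ∷ [] ← bounded perm′ s = <⇒≱ b<c c≤
    decreasing′ (_ ∷ʳ s) m<b b<c with (b ∷ _ ∷ []) , s′ , ≡.refl ← ⊆-map⁻ (raise a) σ s with b≤ ∷ _ ← bounded permutation s′ =
      decreasing s′ (≡.subst (m <_) (raise-< (s≤s b≤)) m<b) (raise-cancel-< a b<c)
    ascent′ : m ≡ 0 ⊎ (∃ λ c → m ∷ c ∷ [] ⊆ σ × m < c) → m ≡ 0 ⊎ (∃ λ c → m ∷ c ∷ [] ⊆ prepend a σ × m < c)
    ascent′ (inj₁ m≡0)           = inj₁ m≡0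
    ascent′ (inj₂ (c , s , m<c)) = inj₂ (raise a c
      , ≡.subst (λ b → b ∷ raise a c ∷ [] ⊆ prepend a σ) (raise-< m<a) (a ∷ʳ map⁺ (raise a) s)
      , <-≤-trans m<c (raise-inflates a c))
    descent′ : (∃ λ ρ → σ ≡ headLetter κ m k ∷ ρ) → initialDescent (prepend a σ) ≡ true
    descent′ (ρ , ≡.refl) with h≤ ∷ _ ← bounded {τ = headLetter κ m k ∷ []} permutation (≡.refl ∷ minimum ρ) =
      dec-true (raise a h <? a) (≡.subst (_< a) (≡.sym (raise-< (s≤s h≤))) (s≤s h≤))
      where h = headLetter κ m k

  -- The raised maximum follows `a`, so `a` begins an ascending pair. A larger letter beginning one
  -- would come from a letter of `σ` above m. Hence `a` is the new m.
  lowChild-valid : ∀ {σ m k κ ν} → Valid (node σ m k κ) → LowChild σ (next κ) m k ν → Valid ν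
  lowChild-valid {σ} {m} {k} {κ} valid (lowChild {a} {j} m<a e) = record
    { permutation = ≡.subst (λ n → IsPermutation n (prepend a σ)) (≡.sym e)
                      (prepend-permutation permutation (≤-trans (s≤s z≤n) m<a) (≤-trans a≤m+k (n≤1+n _)))
    ; no123       = prepend-no123 valid m<a
    ; decreasing  = decreasing′
    ; ascent      = inj₂ (suc (m + k) , ≡.refl ∷ from∈ max∈′ , s≤s a≤m+k)
    ; max∈        = there (≡.subst (_∈ map (raise a) σ) (≡.sym e) max∈′)
    ; starts      = starts′ κ
    ; descent     = descent′ κ starts
    }
    where
    open Valid valid
    a≤m+k : a ≤ m + k
    a≤m+k = ≤-trans (m≤m+n a j) (≤-reflexive (suc-injective (≡.trans (≡.sym (+-suc a j)) e)))
    max∈′ : suc (m + k) ∈ map (raise a) σ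
    max∈′ = ≡.subst (_∈ map (raise a) σ) (raise-≥ a≤m+k) (∈-map⁺ (raise a) max∈)
    decreasing′ : ∀ {b c} → b ∷ c ∷ [] ⊆ prepend a σ → a < b → ¬ b < c
    decreasing′ (≡.refl ∷ _) a<a _ = <-irrefl ≡.refl a<a
    decreasing′ (_ ∷ʳ s) a<b b<c with (_ ∷ _ ∷ []) , s′ , ≡.refl ← ⊆-map⁻ (raise a) σ s =
      decreasing s′ (<-≤-trans m<a (<raise⇒≤ a<b)) (raise-cancel-< a b<c)
    starts′ : ∀ κ → ∃ λ ρ → prepend a σ ≡ headLetter (next κ) a (suc j) ∷ ρ
    starts′ (top _) = _ , ≡.refl
    starts′ (low _) = _ , ≡.refl
    descent′ : ∀ κ → (∃ λ ρ → σ ≡ headLetter κ m k ∷ ρ) → initialDescent (prepend a σ) ≡ startsWithDescent (next κ)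
    descent′ (top _) (_ , ≡.refl) = dec-false (raise a (m + k) <? a) (≤⇒≯ (≤-trans a≤m+k (raise-inflates a (m + k))))
    descent′ (low _) (_ , ≡.refl) = dec-true (raise a m <? a) (≡.subst (_< a) (≡.sym (raise-< m<a)) m<a)

  generation-valid : ∀ n → All Valid (generation n)
  generation-valid zero    = record
    { permutation = ≡.refl , (≤-refl , ≤-refl) ∷ [] , [] ∷ []
    ; no123       = λ { (_ ∷ʳ ()) ; (≡.refl ∷ ()) }
    ; decreasing  = λ { (_ ∷ʳ ()) ; (≡.refl ∷ ()) }
    ; ascent      = inj₁ ≡.refl
    ; max∈        = here ≡.refl
    ; starts      = _ , ≡.refl
    ; descent     = ≡.refl
    } ∷ []
  generation-valid (suc n) = All.concat⁺ (All.map⁺ (All.map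
    (λ valid → topChild-valid valid ∷ All.map (lowChild-valid valid) (lowChildren-All _ _ _ _))
    (generation-valid n)))

  -- No permutation is generated twice.

  _≢ʷ_ : Node → Node → Set
  _≢ʷ_ = _≢_ on word

  lowChildren-distinct : ∀ σ κ m k → AllPairs _≢ʷ_ (lowChildren σ κ m k)
  lowChildren-distinct σ κ m zero    = []
  lowChildren-distinct σ κ m (suc k) =
      All.map (λ { (lowChild m<a _) e → <⇒≢ m<a (proj₁ (prepend-injective e)) }) (lowChildren-All σ κ (suc m) k)
    ∷ lowChildren-distinct σ κ (suc m) k

  lowChild-≤ : ∀ {σ κ m k ν} → LowChild σ κ m k ν → ∃ λ a → a ≤ m + k × word ν ≡ prepend a σ
  lowChild-≤ (lowChild {a} {j} _ e) = a , ≤-trans (m≤m+n a j) (≤-reflexive (suc-injective (≡.trans (≡.sym (+-suc a j)) e))) , ≡.refl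

  children-distinct : ∀ ν → AllPairs _≢ʷ_ (children ν)
  children-distinct (node σ m k κ) =
      All.map (λ lc e → let a , a≤ , e′ = lowChild-≤ lc in <⇒≢ (s≤s a≤) (≡.sym (proj₁ (prepend-injective (≡.trans e e′)))))
        (lowChildren-All σ (next κ) m k)
    ∷ lowChildren-distinct σ (next κ) m k

  children-prepend : ∀ ν → All (λ μ → ∃ λ a → word μ ≡ prepend a (word ν)) (children ν)
  children-prepend ν = (_ , ≡.refl) ∷ All.map (λ { (lowChild _ _) → _ , ≡.refl }) (lowChildren-All _ _ _ _)

  generation-length : ∀ n → All (λ ν → length (word ν) ≡ suc n) (generation n)
  generation-length zero    = ≡.refl ∷ []
  generation-length (suc n) = All.concat⁺ (All.map⁺ (All.map
    (λ {ν} ≡n → All.map (λ (a , e) → ≡.trans (≡.cong length e) (≡.cong suc (≡.trans (List.length-map (raise a) (word ν)) ≡n)))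
                  (children-prepend ν))
    (generation-length n)))

  -- Siblings differ in their first letter; children of different parents differ because `prepend`
  -- determines the word that it extends.
  generation-distinct : ∀ n → AllPairs _≢ʷ_ (generation n)
  generation-distinct zero    = [] ∷ []
  generation-distinct (suc n) = AllPairs.concat⁺
    (All.map⁺ (All.universal children-distinct (generation n)))
    (AllPairs.map⁺ (AllPairs.map
      (λ {ν} {μ} ν≢μ → All.map (λ (a , e) → All.map (λ (b , e′) e″ →
         ν≢μ (proj₂ (prepend-injective (≡.trans (≡.sym e) (≡.trans e″ e′))))) (children-prepend μ)) (children-prepend ν))
      (generation-distinct n)))

  -- Every 123-avoiding permutation is generated.

  map-raise-lower : ∀ {a} σ → All (a ≢_) σ → map (raise a) (map (lower a) σ) ≡ σ
  map-raise-lower []      []          = ≡.refl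
  map-raise-lower (b ∷ σ) (a≢b ∷ a∉σ) = ≡.cong₂ _∷_ (raise-lower a≢b) (map-raise-lower σ a∉σ)

  lower-bounds : ∀ {n a} → 1 ≤ a → a ≤ suc n → ∀ {b} → a ≢ b × 1 ≤ b × b ≤ suc n → 1 ≤ lower a b × lower a b ≤ n
  lower-bounds {n} {a} 1≤a a≤ {b} (a≢b , 1≤b , b≤) with <-≤-connex a b
  ... | inj₂ b≤a rewrite lower-≤ b≤a = 1≤b , ≤-pred (<-≤-trans (≤∧≢⇒< b≤a (a≢b ∘ ≡.sym)) a≤)
  ... | inj₁ a<b@(s≤s a≤pred-b) rewrite lower-> a<b = ≤-trans 1≤a a≤pred-b , ≤-pred b≤

  prepend-permutation⁻ : ∀ {n τ} → IsPermutation (suc n) τ → ∃₂ λ a σ → τ ≡ prepend a σ × 1 ≤ a × a ≤ suc n × IsPermutation n σ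
  prepend-permutation⁻ {n} {a ∷ τ} (≡n , (1≤a , a≤) ∷ letters , a∉τ ∷ unique) =
      a , σ , ≡.cong (a ∷_) (≡.sym raised) , 1≤a , a≤
    , ≡.trans (List.length-map (lower a) τ) (suc-injective ≡n)
    , All.map⁺ (All.map (lower-bounds 1≤a a≤) (All.zip (a∉τ , letters)))
    -- `lower a` sends both `a` and a + 1 to `a`, so distinctness is read off from the raised word
    -- instead.
    , AllPairs.map (λ ≢ e → ≢ (≡.cong (raise a) e)) (AllPairs.map⁻ (≡.subst Unique (≡.sym raised) unique))
    where
    σ = map (lower a) τ
    raised = map-raise-lower τ a∉τ

  -- Without its first letter the permutation still avoids 123, so the remainder is in the tree by
  -- induction; it remains to see that the first letter is admissible.
  generation-complete : ∀ n {τ} → IsPermutation (suc n) τ → No123 τ → ∃ λ ν → ν ∈ generation n × word ν ≡ τ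
  generation-complete zero {b ∷ []} (_ , (1≤b , b≤1) ∷ [] , _) _ with ≡.refl ← ≤-antisym b≤1 1≤b = _ , here ≡.refl , ≡.refl
  generation-complete (suc n) perm free with prepend-permutation⁻ perm
  ... | a , σ , ≡.refl , 1≤a , a≤ , perm-σ
    with node σ m k κ , ν∈ , ≡.refl ← generation-complete n perm-σ
           (λ s b<c c<d → free (a ∷ʳ map⁺ (raise a) s) (raise-mono-< a b<c) (raise-mono-< a c<d)) =
    let μ , μ∈ , e = child in μ , ∈-concatMap⁺ children (lose ν∈ μ∈) , e
    where
    open Valid (All.lookup (generation-valid n) ν∈)
    m+k≡ : m + k ≡ suc n
    m+k≡ = ≡.trans (≡.sym (proj₁ permutation)) (proj₁ perm-σ)
    m<a : m < a
    m<a with ascent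
    ... | inj₁ ≡.refl = 1≤a
    -- If a ≤ m, the ascending pair that begins with m is raised above `a` and completes a 123.
    ... | inj₂ (c , s , m<c) = ≰⇒> λ a≤m → free (≡.refl ∷ map⁺ (raise a) s)
            (≤-trans (s≤s a≤m) (≤-reflexive (≡.sym (raise-≥ a≤m)))) (raise-mono-< a m<c)
    child : ∃ λ μ → μ ∈ children (node σ m k κ) × word μ ≡ prepend a σ
    child with m≤n⇒m<n∨m≡n a≤
    ... | inj₂ a≡       = _ , here ≡.refl , ≡.cong (λ b → prepend b σ) (≡.trans (≡.cong suc m+k≡) (≡.sym a≡))
    ... | inj₁ (s≤s a≤n) =
      let μ , μ∈ , e = ∈-lowChildren σ (next κ) m k m<a (≤-trans a≤n (≤-reflexive (≡.sym m+k≡))) in μ , there μ∈ , e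

  -- Both lists are free of repetitions and have the same members.
  generation↭ : ∀ n → map word (generation n) ↭ 𝒮[ suc n ] 123′
  generation↭ n = ∼bag⇒↭ (unique∧set⇒bag (AllPairs.map⁺ (generation-distinct n)) (𝒮-avoiding-unique (suc n) 123′) (mk⇔ to from))
    where
    to : ∀ {τ} → τ ∈ map word (generation n) → τ ∈ 𝒮[ suc n ] 123′
    to τ∈ with ν , ν∈ , ≡.refl ← ∈-map⁻ word τ∈ =
      ∈-filter⁺ (avoids? 123′) (∈-𝒮⁺ (≡.subst (λ l → IsPermutation l (word ν)) m+k≡ permutation)) (No123⇒avoids no123)
      where
      open Valid (All.lookup (generation-valid n) ν∈)
      m+k≡ = ≡.trans (≡.sym (proj₁ permutation)) (All.lookup (generation-length n) ν∈)
    from : ∀ {τ} → τ ∈ 𝒮[ suc n ] 123′ → τ ∈ map word (generation n)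
    from τ∈ =
      let τ∈𝒮 , av = ∈-filter⁻ (avoids? 123′) {xs = 𝒮 (suc n)} τ∈
          ν , ν∈ , e = generation-complete n (∈-𝒮⁻ τ∈𝒮) (avoids⇒No123 av)
      in ≡.subst (_∈ map word (generation n)) e (∈-map⁺ word ν∈)

-- The weights of the nodes and the coefficients of `A`.

module Weights where
  open Exp C.semiring using (_^_)
  open CommutativeSemigroupProperties C.*-commutativeSemigroup using (interchange)
  open CommutativeSemigroupProperties C.+-commutativeSemigroup using (x∙yz≈y∙xz)
  open import Relation.Binary.Reasoning.Setoid C.setoid
  open import Data.Nat.Properties using (_<?_; _≟_)
  open Generation
  open Node

  mch : Word → ℕ
  mch = 321′ -mch

  monomial : ℕ → ℕ → C.Carrier
  monomial d e = yₚ ^ d C.* xₚ ^ e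

  monomial-y : ∀ d e → monomial (suc d) e C.≈ yₚ C.* monomial d e
  monomial-y d e = C.*-assoc yₚ (yₚ ^ d) (xₚ ^ e)

  monomial-xy : ∀ d e → monomial (suc d) (suc e) C.≈ (xₚ C.* yₚ) C.* monomial d e
  monomial-xy d e = C.trans (interchange yₚ (yₚ ^ d) xₚ (xₚ ^ e)) (C.*-congʳ (C.*-comm yₚ xₚ))

  weight : Word → C.Carrier
  weight σ = monomial (des σ) (mch σ)

  private
    -- `descent?` and `match?` name the tests inside `des` and `-mch`, so that the filter lemmas
    -- apply to these statistics.
    descent? : (p : ℕ × ℕ) → Dec (proj₂ p < proj₁ p)
    descent? p = proj₂ p <? proj₁ p
    match? : ∀ w → Dec (red w ≡ 321′)
    match? w = List.≡-dec _≟_ (red w) 321′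

  des-descent : ∀ {a b} σ → b < a → des (a ∷ b ∷ σ) ≡ suc (des (b ∷ σ))
  des-descent {a} {b} σ b<a = ≡.cong length (List.filter-accept descent? {a , b} {zip (b ∷ σ) σ} b<a)

  des-ascent : ∀ {a b} σ → ¬ b < a → des (a ∷ b ∷ σ) ≡ des (b ∷ σ)
  des-ascent {a} {b} σ b≮a = ≡.cong length (List.filter-reject descent? {a , b} {zip (b ∷ σ) σ} b≮a)

  private
    mch-accept : ∀ a σ → red (take 3 (a ∷ σ)) ≡ 321′ → mch (a ∷ σ) ≡ suc (mch σ)
    mch-accept a σ e = ≡.cong length (List.filter-accept match? {take 3 (a ∷ σ)} {map (take 3) (tails σ)} e)

    mch-reject : ∀ a σ → ¬ red (take 3 (a ∷ σ)) ≡ 321′ → mch (a ∷ σ) ≡ mch σ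
    mch-reject a σ e = ≡.cong length (List.filter-reject match? {take 3 (a ∷ σ)} {map (take 3) (tails σ)} e)

  mch-match : ∀ {a b c} σ → b < a → c < b → mch (a ∷ b ∷ c ∷ σ) ≡ suc (mch (b ∷ c ∷ σ))
  mch-match {a} {b} {c} σ b<a c<b = mch-accept a (b ∷ c ∷ σ) (red-decreasing⁺ b<a c<b)

  mch-mismatch : ∀ {a b c} σ → ¬ (b < a × c < b) → mch (a ∷ b ∷ c ∷ σ) ≡ mch (b ∷ c ∷ σ)
  mch-mismatch {a} {b} {c} σ ¬desc = mch-reject a (b ∷ c ∷ σ) λ e → ¬desc (red-decreasing⁻ e)

  mch-short₁ : ∀ a → mch (a ∷ []) ≡ 0
  mch-short₁ a = mch-reject a [] λ e → contradiction (red-length (a ∷ []) e) λ ()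

  mch-short₂ : ∀ a b → mch (a ∷ b ∷ []) ≡ 0
  mch-short₂ a b = ≡.trans
    (mch-reject a (b ∷ []) λ e → contradiction (red-length (a ∷ b ∷ []) e) λ ())
    (mch-short₁ b)

  private
    weight-≡ : ∀ σ {d e} → des σ ≡ d → mch σ ≡ e → weight σ ≡ monomial d e
    weight-≡ σ des≡ mch≡ = ≡.cong₂ monomial des≡ mch≡

  weight-singleton : ∀ a → weight (a ∷ []) C.≈ C.1#
  weight-singleton a = C.trans (C.reflexive (weight-≡ (a ∷ []) ≡.refl (mch-short₁ a))) (C.*-identityˡ C.1#)

  weight-ascent : ∀ {a b} σ → ¬ b < a → weight (a ∷ b ∷ σ) C.≈ weight (b ∷ σ)
  weight-ascent {a} {b} σ b≮a = C.reflexive (weight-≡ (a ∷ b ∷ σ) (des-ascent σ b≮a) (no-match σ))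
    where
    no-match : ∀ σ → mch (a ∷ b ∷ σ) ≡ mch (b ∷ σ)
    no-match []      = ≡.trans (mch-short₂ a b) (≡.sym (mch-short₁ b))
    no-match (c ∷ σ) = mch-mismatch {a} σ λ (b<a , _) → b≮a b<a

  -- The new descent contributes y, and its window is a 321-match exactly when `b` starts a descent.
  weight-descent : ∀ {a b} σ → b < a → weight (a ∷ b ∷ σ) C.≈ descentWeight (initialDescent (b ∷ σ)) C.* weight (b ∷ σ)
  weight-descent {a} {b} σ b<a = begin
    weight (a ∷ b ∷ σ)                                               ≡⟨ weight-≡ (a ∷ b ∷ σ) (des-descent σ b<a) ≡.refl ⟩
    monomial (suc (des (b ∷ σ))) (mch (a ∷ b ∷ σ))                   ≈⟨ case σ (des (b ∷ σ)) ⟩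
    descentWeight (initialDescent (b ∷ σ)) C.* weight (b ∷ σ)        ∎
    where
    -- The number of descents is abstracted to `d`, as only the count of matches needs the shape of
    -- `σ`.
    case : ∀ σ d → monomial (suc d) (mch (a ∷ b ∷ σ))
                   C.≈ descentWeight (initialDescent (b ∷ σ)) C.* monomial d (mch (b ∷ σ))
    case [] d = C.trans
      (C.reflexive (≡.cong (monomial (suc d)) (≡.trans (mch-short₂ a b) (≡.sym (mch-short₁ b)))))
      (monomial-y d (mch (b ∷ [])))
    case (c ∷ σ) d = step (ℕ.<-≤-connex c b)
      where
      e = mch (b ∷ c ∷ σ)
      step : c < b ⊎ b ≤ c →
             monomial (suc d) (mch (a ∷ b ∷ c ∷ σ)) C.≈ descentWeight (does (c <? b)) C.* monomial d e
      step (inj₁ c<b) = begin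
        monomial (suc d) (mch (a ∷ b ∷ c ∷ σ))
          ≡⟨ ≡.cong (monomial (suc d)) (mch-match {a} σ b<a c<b) ⟩
        monomial (suc d) (suc e)
          ≈⟨ monomial-xy d e ⟩
        descentWeight true C.* monomial d e
          ≡⟨ ≡.cong (λ r → descentWeight r C.* monomial d e) (dec-true (c <? b) c<b) ⟨
        descentWeight (does (c <? b)) C.* monomial d e ∎
      step (inj₂ b≤c) = begin
        monomial (suc d) (mch (a ∷ b ∷ c ∷ σ))
          ≡⟨ ≡.cong (monomial (suc d)) (mch-mismatch {a} σ λ (_ , c<b) → ℕ.≤⇒≯ b≤c c<b) ⟩
        monomial (suc d) e
          ≈⟨ monomial-y d e ⟩
        descentWeight false C.* monomial d e
          ≡⟨ ≡.cong (λ r → descentWeight r C.* monomial d e) (dec-false (c <? b) (ℕ.≤⇒≯ b≤c)) ⟨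
        descentWeight (does (c <? b)) C.* monomial d e ∎

  initialDescent-raise : ∀ a σ → initialDescent (map (raise a) σ) ≡ initialDescent σ
  initialDescent-raise a []          = ≡.refl
  initialDescent-raise a (b ∷ [])    = ≡.refl
  initialDescent-raise a (b ∷ c ∷ σ) with c <? b
  ... | yes c<b = ≡.trans (dec-true (raise a c <? raise a b) (raise-mono-< a c<b)) (≡.sym (dec-true (c <? b) c<b))
  ... | no  c≮b = ≡.trans (dec-false (raise a c <? raise a b) (λ r → c≮b (raise-cancel-< a r))) (≡.sym (dec-false (c <? b) c≮b))

  -- The weight depends only on comparisons of letters; the induction peels off the first letter by
  -- `weight-descent` or `weight-ascent`.
  weight-raise : ∀ a b σ → weight (map (raise a) (b ∷ σ)) C.≈ weight (b ∷ σ)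
  weight-raise a b []      = C.trans (weight-singleton (raise a b)) (C.sym (weight-singleton b))
  weight-raise a b (c ∷ σ) = step (ℕ.<-≤-connex c b)
    where
    step : c < b ⊎ b ≤ c → weight (map (raise a) (b ∷ c ∷ σ)) C.≈ weight (b ∷ c ∷ σ)
    step (inj₁ c<b) = begin
      weight (map (raise a) (b ∷ c ∷ σ))
        ≈⟨ weight-descent (map (raise a) σ) (raise-mono-< a c<b) ⟩
      descentWeight (initialDescent (map (raise a) (c ∷ σ))) C.* weight (map (raise a) (c ∷ σ))
        ≈⟨ C.*-cong (C.reflexive (≡.cong descentWeight (initialDescent-raise a (c ∷ σ)))) (weight-raise a c σ) ⟩
      descentWeight (initialDescent (c ∷ σ)) C.* weight (c ∷ σ)
        ≈⟨ weight-descent σ c<b ⟨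
      weight (b ∷ c ∷ σ) ∎
    step (inj₂ b≤c) = begin
      weight (map (raise a) (b ∷ c ∷ σ))   ≈⟨ weight-ascent (map (raise a) σ) (λ r → ℕ.≤⇒≯ b≤c (raise-cancel-< a r)) ⟩
      weight (map (raise a) (c ∷ σ))       ≈⟨ weight-raise a c σ ⟩
      weight (c ∷ σ)                       ≈⟨ weight-ascent σ (ℕ.≤⇒≯ b≤c) ⟨
      weight (b ∷ c ∷ σ)                   ∎

  weight-prepend-descent : ∀ {a b} σ → b < a → weight (prepend a (b ∷ σ)) C.≈ descentWeight (initialDescent (b ∷ σ)) C.* weight (b ∷ σ)
  weight-prepend-descent {a} {b} σ b<a = begin
    weight (prepend a (b ∷ σ))
      ≈⟨ weight-descent (map (raise a) σ) (≡.subst (_< a) (≡.sym (raise-< b<a)) b<a) ⟩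
    descentWeight (initialDescent (map (raise a) (b ∷ σ))) C.* weight (map (raise a) (b ∷ σ))
      ≈⟨ C.*-cong (C.reflexive (≡.cong descentWeight (initialDescent-raise a (b ∷ σ)))) (weight-raise a b σ) ⟩
    descentWeight (initialDescent (b ∷ σ)) C.* weight (b ∷ σ) ∎

  weight-prepend-ascent : ∀ {a b} σ → a ≤ b → weight (prepend a (b ∷ σ)) C.≈ weight (b ∷ σ)
  weight-prepend-ascent {a} {b} σ a≤b = C.trans
    (weight-ascent (map (raise a) σ) (ℕ.≤⇒≯ (ℕ.≤-trans a≤b (raise-inflates a b)))) (weight-raise a b σ)

  sumOver : ∀ {a} {B : Set a} → (B → C.Carrier) → List B → C.Carrier
  sumOver f []       = C.0#
  sumOver f (b ∷ bs) = f b C.+ sumOver f bs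

  sumOver≡foldr : ∀ {a} {B : Set a} (f : B → C.Carrier) bs → sumOver f bs ≡ foldr C._+_ C.0# (map f bs)
  sumOver≡foldr f []       = ≡.refl
  sumOver≡foldr f (b ∷ bs) = ≡.cong (f b C.+_) (sumOver≡foldr f bs)

  sumOver-map : ∀ {a b} {B : Set a} {D : Set b} (f : D → C.Carrier) (g : B → D) bs → sumOver f (map g bs) ≡ sumOver (λ b → f (g b)) bs
  sumOver-map f g []       = ≡.refl
  sumOver-map f g (b ∷ bs) = ≡.cong (f (g b) C.+_) (sumOver-map f g bs)

  sumOver-cong : ∀ {a} {B : Set a} {f g : B → C.Carrier} {bs} → All (λ b → f b C.≈ g b) bs → sumOver f bs C.≈ sumOver g bs
  sumOver-cong []       = C.refl
  sumOver-cong (p ∷ ps) = C.+-cong p (sumOver-cong ps)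

  sumOver-++ : ∀ {a} {B : Set a} (f : B → C.Carrier) bs cs → sumOver f (bs ++ cs) C.≈ sumOver f bs C.+ sumOver f cs
  sumOver-++ f []       cs = C.sym (C.+-identityˡ _)
  sumOver-++ f (b ∷ bs) cs = C.trans (C.+-congˡ (sumOver-++ f bs cs)) (C.sym (C.+-assoc _ _ _))

  sumOver-concatMap : ∀ {a b} {B : Set a} {D : Set b} (f : D → C.Carrier) (g : B → List D) bs →
                      sumOver f (concatMap g bs) C.≈ sumOver (λ b → sumOver f (g b)) bs
  sumOver-concatMap f g []       = C.refl
  sumOver-concatMap f g (b ∷ bs) = C.trans (sumOver-++ f (g b) (concatMap g bs)) (C.+-congˡ (sumOver-concatMap f g bs))

  sumOver-↭ : ∀ {a} {B : Set a} (f : B → C.Carrier) {bs cs} → bs ↭ cs → sumOver f bs C.≈ sumOver f cs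
  sumOver-↭ f ↭.refl         = C.refl
  sumOver-↭ f (↭.prep b p)   = C.+-congˡ (sumOver-↭ f p)
  sumOver-↭ f (↭.swap b c p) = C.trans (x∙yz≈y∙xz _ _ _) (C.+-congˡ (C.+-congˡ (sumOver-↭ f p)))
  sumOver-↭ f (↭.trans p q)  = C.trans (sumOver-↭ f p) (sumOver-↭ f q)

  -- For a valid node, the total weight of its descendants n generations later.
  nodeWeight : ℕ → Node → C.Carrier
  nodeWeight n ν = weight (word ν) C.* extensions n (kind ν) (k ν)

  private
    push : ∀ {w a b c} → w C.≈ a C.* b → w C.* c C.≈ b C.* (a C.* c)
    push {w} {a} {b} {c} w≈ab = C.trans (C.*-congʳ (C.trans w≈ab (C.*-comm a b))) (C.*-assoc b a c)

  -- All low letters gain the same factor `c`, and the children have k, k - 1, ..., 1 in turn; hence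
  -- the partial sum.
  sumOver-lowChildren : ∀ n {σ κ c} m k → (∀ {a} → m < a → a ≤ m ℕ.+ k → weight (prepend a σ) C.≈ c C.* weight σ) →
                        sumOver (nodeWeight n) (lowChildren σ κ m k) C.≈ weight σ C.* (c C.* KC.partialSum (extensions n κ) k)
  sumOver-lowChildren n {σ} {κ} {c} m zero    w = C.sym (C.trans (C.*-congˡ (C.zeroʳ c)) (C.zeroʳ (weight σ)))
  sumOver-lowChildren n {σ} {κ} {c} m (suc k) w = begin
    nodeWeight n (node (prepend (suc m) σ) (suc m) (suc k) κ) C.+ sumOver (nodeWeight n) (lowChildren σ κ (suc m) k)
      ≈⟨ C.+-cong (push (w ℕ.≤-refl (≡.subst (suc m ≤_) (≡.sym (ℕ.+-suc m k)) (s≤s (ℕ.m≤m+n m k)))))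
                  (sumOver-lowChildren n (suc m) k λ {a} sm<a a≤ →
                    w (ℕ.<-trans ℕ.≤-refl sm<a) (≡.subst (a ≤_) (≡.sym (ℕ.+-suc m k)) a≤)) ⟩
    weight σ C.* (c C.* e) C.+ weight σ C.* (c C.* r)
      ≈⟨ C.distribˡ _ _ _ ⟨
    weight σ C.* (c C.* e C.+ c C.* r)
      ≈⟨ C.*-congˡ (C.distribˡ _ _ _) ⟨
    weight σ C.* (c C.* (e C.+ r)) ∎
    where
    e = extensions n κ (suc k)
    r = KC.partialSum (extensions n κ) k

  -- One unfolding of `extensions`: the new maximum gives its first summand, the low letters give
  -- the second.
  sumOver-children : ∀ n {ν} → Valid ν → sumOver (nodeWeight n) (children ν) C.≈ nodeWeight (suc n) ν
  sumOver-children n {node σ m k κ} valid = C.trans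
    (C.+-cong (push (top-weight starts)) (sumOver-lowChildren n m k (low-weight κ starts descent)))
    (C.sym (C.distribˡ _ _ _))
    where
    open Valid valid
    top-weight : (∃ λ ρ → σ ≡ headLetter κ m k ∷ ρ) → weight (prepend (suc (m ℕ.+ k)) σ) C.≈ topWeight κ C.* weight σ
    top-weight (ρ , ≡.refl) = C.trans
      (weight-prepend-descent ρ (s≤s (proj₂ (All.head (proj₁ (proj₂ permutation))))))
      (C.*-congʳ (C.reflexive (≡.cong descentWeight descent)))
    low-weight : ∀ κ → (∃ λ ρ → σ ≡ headLetter κ m k ∷ ρ) → initialDescent σ ≡ startsWithDescent κ →
                 ∀ {a} → m < a → a ≤ m ℕ.+ k → weight (prepend a σ) C.≈ lowWeight κ C.* weight σ
    low-weight (top _) (ρ , ≡.refl) _ m<a a≤ = C.trans (weight-prepend-ascent ρ a≤) (C.sym (C.*-identityˡ _))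
    low-weight (low _) (ρ , ≡.refl) d m<a a≤ = C.trans (weight-prepend-descent ρ m<a) (C.*-congʳ (C.reflexive (≡.cong descentWeight d)))

  -- The induction on i moves one letter at a time from the generation already built to the n
  -- letters still to come.
  sumOver-generation : ∀ i n → sumOver (nodeWeight n) (generation i) C.≈ extensions (i ℕ.+ n) (top false) 1
  sumOver-generation zero    n = C.trans (C.+-identityʳ _) (C.trans (C.*-congʳ (weight-singleton 1)) (C.*-identityˡ _))
  sumOver-generation (suc i) n = begin
    sumOver (nodeWeight n) (concatMap children (generation i))          ≈⟨ sumOver-concatMap (nodeWeight n) children (generation i) ⟩
    sumOver (λ ν → sumOver (nodeWeight n) (children ν)) (generation i)  ≈⟨ sumOver-cong (All.map (sumOver-children n) (generation-valid i)) ⟩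
    sumOver (nodeWeight (suc n)) (generation i)                         ≈⟨ sumOver-generation i (suc n) ⟩
    extensions (i ℕ.+ suc n) (top false) 1                              ≡⟨ ≡.cong (λ l → extensions l (top false) 1) (ℕ.+-suc i n) ⟩
    extensions (suc i ℕ.+ n) (top false) 1                              ∎

  coeff-A-suc : ∀ n → Sᵗ.coeff A (suc n) C.≈ extensions n (top false) 1
  coeff-A-suc n = begin
    foldr C._+_ C.0# (map weight (𝒮[ suc n ] 123′))   ≡⟨ sumOver≡foldr weight (𝒮[ suc n ] 123′) ⟨
    sumOver weight (𝒮[ suc n ] 123′)                  ≈⟨ sumOver-↭ weight (generation↭ n) ⟨
    sumOver weight (map word (generation n))          ≡⟨ sumOver-map weight word (generation n) ⟩
    sumOver (λ ν → weight (word ν)) (generation n)    ≈⟨ sumOver-cong (All.universal (λ ν → C.sym (C.*-identityʳ _)) (generation n)) ⟩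
    sumOver (nodeWeight 0) (generation n)             ≈⟨ sumOver-generation n 0 ⟩
    extensions (n ℕ.+ 0) (top false) 1                ≡⟨ ≡.cong (λ l → extensions l (top false) 1) (ℕ.+-identityʳ n) ⟩
    extensions n (top false) 1                        ∎

  A-first-letter : A S.≈ S.1# S.+ t S.* F (top false) 1
  A-first-letter = ≈1+X* A (F (top false) 1) (C.trans (C.+-identityʳ _) (C.*-identityˡ C.1#)) coeff-A-suc

-- The closed form.

open Weights using (A-first-letter)
open KS.Tree x y t M P Q M-rec P-rec Q-rec

half : S.Carrier
half = const ½ₚ

half+half≈1 : half S.+ half S.≈ S.1#
half+half≈1 = S.trans (S.sym (const-+ ½ₚ ½ₚ)) (S.trans const-cong const-1)
  where
  const-cong : const (½ₚ C.+ ½ₚ) S.≈ const C.1#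
  const-cong = Sᵗ.mk≈ λ { zero → ½ₚ+½ₚ≈1 ; (suc _) → C.refl }

open KS.HalfRoots x y t (√ radicand) half half+half≈1 √radicand-square
open Annihilation V V′ V+V′≈1 VV′≈κ

-- Here the branch of the square root matters: its constant term 1 makes `V′` the root without
-- constant term.
V′-constant-term : Sᵗ.coeff V′ 0 C.≈ C.0#
V′-constant-term = C.trans (Sᵗ.*-head half (S.1# S.- √ radicand))
  (C.trans (C.*-congˡ (x≈y⇒x∙y⁻¹≈ε (C.sym √radicand-constant-term))) (C.zeroʳ ½ₚ))
  where open RingProperties C.ring using (x≈y⇒x∙y⁻¹≈ε)

E₀≈0 : E 0 S.≈ S.0#
E₀≈0 = contraction V′ E V′-constant-term E-rec 0

open Frac using (_≈_; _-_; _/_⟨_⟩; ι)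

theorem3 : ι A ≈ ι ℚ[x,y]⟦t⟧.1# - numerator / denominator ⟨ denominator≉0 ⟩
theorem3 = begin
  A * (1# * denominator)
    -- The denominator is 2ty²D³, so A · D is multiplied by 2ty²D². There M 1 has the coefficient
    -- 2pκ², since κ² = t²y²D². With `w` for V′², `M₁-closed` turns this term into 2p²w, and `V′²`
    -- brings in the root `s` with coefficient -p², matching the numerator.
    ≈⟨ solve 7 (λ x y t s a m w → let D = :D x y t ; κ = :κ x y t ; g = :g x y t ; p = :p x y t ; d = :denominator x y t in
         a :* (:1 :* d) := (:1 :* d :- :numerator x y t s :* :1) :* :1
           :+ 2 :· t :* y :^ 2 :* D :^ 2 :* (a :* D :- (D :* (:1 :- t :^ 2 :* y :* (:1 :- x)) :+ t :* p :* (m :- g)))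
           :+ 2 :· p :* (κ :* κ :* m :- w :* p)
           :+ p :* p :* (2 :· w :- (:1 :- 2 :· κ :- s)))
         S.refl x y t (√ radicand) A (M 1) (V′ * V′) ⟩
  _ ≈⟨ absorb _ V′² ⟩
  _ ≈⟨ absorb _ (M₁-closed E₀≈0) ⟩
  _ ≈⟨ absorb _ (D*A A (F (top false) 1) A-first-letter singleton-rec) ⟩
  (1# * denominator S.- numerator * 1#) * 1# ∎
  where
  open S using (_*_; 1#)
  open IntegerSolver ℚ[x,y]⟦t⟧.commutativeRing
  open KS using (absorb; _:·_; :1; :D; :κ; :g; :p)
  open import Relation.Binary.Reasoning.Setoid S.setoid
  -- Transcribed literally, so that the evaluated syntax is the stated formula by computation.
  :denominator : ∀ {n} (x y t : Polynomial n) → Polynomial n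
  :denominator x y t = 2 :· t :* y :^ 2 :* (:- (x :^ 2) :* t :* y :+ x :+ t) :^ 3
  :numerator : ∀ {n} (x y t s : Polynomial n) → Polynomial n
  :numerator x y t s =
       2 :· (x :- :1) :^ 2 :* t :^ 6 :* y :^ 3 :* (x :^ 2 :* y :- :1) :^ 2
    :+ t :^ 2 :* (:- (x :^ 2) :* (2 :· x :+ 5 :· :1) :* y :^ 2 :+ (6 :· x :+ 2 :· :1) :* y :- :1)
    :+ 2 :· t :^ 4 :* y :* ( (2 :· :1 :- 3 :· x) :* x :^ 4 :* y :^ 3
                           :+ (3 :· x :^ 2 :+ 2 :· x :- 2 :· :1) :* x :^ 2 :* y :^ 2
                           :- (3 :· x :^ 2 :+ x :- :1) :* y :+ :1 )
    :+ 2 :· (x :- :1) :* t :^ 5 :* y :^ 2 :* (x :^ 5 :* y :^ 3 :- 3 :· x :^ 4 :* y :^ 2 :+ 4 :· x :^ 2 :* y :- x :* y :- :1)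
    :+ 2 :· t :^ 3 :* y :* (3 :· x :^ 4 :* y :^ 2 :- x :^ 3 :* y :- 5 :· x :^ 2 :* y :+ x :+ 2 :· :1)
    :+ t :* (4 :· x :* y :- 2 :· :1)
    :- :1
    :+ (t :* (x :* y :- :1) :- :1) :^ 2 :* s
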